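{- Let $p$ be a prime, $t\ge0$ an integer with $p^t+1\mid p^n-1$, and $F\colon\mathbb F_p^n\to\mathbb F_p^n$ a plateaued function that is $(p^t+1)$-to-$1$. Then $F$ has differential uniformity at least $p^t$. Moreover, $F$ has differential uniformity exactly $p^t$ if and only if for every nonzero $a\in\mathbb F_p^n$ and every $b\in\mathbb F_p^n$ the equation $F(x+a)-F(x)=b$ has either $0$ or $p^t$ solutions $x\in\mathbb F_p^n$.
   Context: Standard scalar product, $\zeta_p=e^{2\pi i/p}$, components $F_b(x)=\langle b,F(x)\rangle$ with $W_F(b,a)=\sum_x\zeta_p^{F_b(x)-\langle a,x\rangle}$. A function $f$ is $s$-plateaued if $|W_f(a)|\in\{0,p^{(n+s)/2}\}$ for all $a$; $F$ is plateaued if every $F_b$, $b\neq0$, is $s_b$-plateaued for some $s_b$. $F$ is $d$-to-$1$ if $d\mid p^n-1$ and $F$ has exactly one preimage set of size $1$ and all other nonempty preimage sets have size $d$. The differential uniformity of $F$ is the maximum, over $a\neq0$ and all $b$, of the number of solutions $x$ of $F(x+a)-F(x)=b$. -}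

module Defs where

open import Data.Nat as ℕ using (ℕ; zero; suc; _^_; _∸_; _⊔_; NonZero)
open import Data.Nat.DivMod using (_mod_)
open import Data.Nat.Divisibility using (_∣_)
open import Data.Fin as Fin using (Fin; toℕ)
open import Data.Vec using (Vec; []; _∷_; zipWith; replicate; foldr)
open import Data.Vec.Properties using (≡-dec)
open import Data.List as List using (List; [_]; map; concatMap; allFin; filter; length)
open import Data.Integer as ℤ using (ℤ; +_)
open import Data.Product using (Σ; ∃; _×_)
open import Data.Sum using (_⊎_)
open import Relation.Binary.PropositionalEquality using (_≡_; _≢_)
open import Relation.Nullary using (¬?)

module _ {p : ℕ} {{nz : NonZero p}} where

  zeroF : Fin p
  zeroF = 0 mod p

  _+F_ : Fin p → Fin p → Fin p
  a +F b = (toℕ a ℕ.+ toℕ b) mod p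

  _*F_ : Fin p → Fin p → Fin p
  a *F b = (toℕ a ℕ.* toℕ b) mod p

  negF : Fin p → Fin p
  negF a = (p ∸ toℕ a) mod p

  _-F_ : Fin p → Fin p → Fin p
  a -F b = a +F negF b

  _+V_ : ∀ {n} → Vec (Fin p) n → Vec (Fin p) n → Vec (Fin p) n
  _+V_ = zipWith _+F_

  _-V_ : ∀ {n} → Vec (Fin p) n → Vec (Fin p) n → Vec (Fin p) n
  _-V_ = zipWith _-F_

  zeroV : ∀ {n} → Vec (Fin p) n
  zeroV = replicate _ zeroF

  dot : ∀ {n} → Vec (Fin p) n → Vec (Fin p) n → Fin p
  dot b x = foldr _ _+F_ zeroF (zipWith _*F_ b x)

  allVecs : ∀ n → List (Vec (Fin p) n)
  allVecs zero = [ [] ]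
  allVecs (suc n) = concatMap (λ i → map (i ∷_) (allVecs n)) (allFin p)

  _≟V_ : ∀ {n} (x y : Vec (Fin p) n) → Relation.Nullary.Dec (x ≡ y)
  _≟V_ = ≡-dec Fin._≟_

  nonzeroVecs : ∀ n → List (Vec (Fin p) n)
  nonzeroVecs n = filter (λ a → ¬? (a ≟V zeroV)) (allVecs n)

  module _ {n : ℕ} (F : Vec (Fin p) n → Vec (Fin p) n) where

    numSol : Vec (Fin p) n → Vec (Fin p) n → ℕ
    numSol a b = length (filter (λ x → ((F (x +V a)) -V (F x)) ≟V b) (allVecs n))

    diffUnif : ℕ
    diffUnif = List.foldr _⊔_ 0
      (concatMap (λ a → map (numSol a) (allVecs n)) (nonzeroVecs n))

    preSize : Vec (Fin p) n → ℕ
    preSize y = length (filter (λ x → F x ≟V y) (allVecs n))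

    IsDTo1 : ℕ → Set
    IsDTo1 d = (d ∣ (p ^ n ∸ 1)) ×
      Σ (Vec (Fin p) n) λ y₀ → (preSize y₀ ≡ 1) ×
        (∀ y → y ≢ y₀ → (preSize y ≡ 0) ⊎ (preSize y ≡ d))

  -- the ring Z[ζ_p], represented as the group ring Z[C_p] (coefficient of ζ^k
  -- at index k) modulo the ideal generated by 1 + ζ + ... + ζ^{p-1}
  Zζ : Set
  Zζ = Fin p → ℤ

  sumℤ : List ℤ → ℤ
  sumℤ = List.foldr ℤ._+_ (+ 0)

  _*ζ_ : Zζ → Zζ → Zζ
  (c *ζ d) k = sumℤ (map (λ i → c i ℤ.* d (k -F i)) (allFin p))

  conjζ : Zζ → Zζ
  conjζ c k = c (negF k)

  absSqζ : Zζ → Zζ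
  absSqζ c = c *ζ conjζ c

  -- c equals the rational integer N in Z[ζ_p]
  _≈ℤ_ : Zζ → ℤ → Set
  c ≈ℤ N = ∃ λ m → (c zeroF ≡ m ℤ.+ N) × (∀ k → k ≢ zeroF → c k ≡ m)

  -- Walsh transform W_f(a) = Σ_x ζ_p^{f(x) - <a,x>}
  walsh : ∀ {n} → (Vec (Fin p) n → Fin p) → Vec (Fin p) n → Zζ
  walsh {n} f a k = + length (filter (λ x → (f x -F dot a x) Fin.≟ k) (allVecs n))

  -- f is s-plateaued: |W_f(a)| ∈ {0, p^{(n+s)/2}}, i.e. |W_f(a)|^2 ∈ {0, p^{n+s}}
  IsSPlateaued : ∀ {n} → (Vec (Fin p) n → Fin p) → ℕ → Set
  IsSPlateaued {n} f s = ∀ a →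
    (absSqζ (walsh f a) ≈ℤ (+ 0)) ⊎ (absSqζ (walsh f a) ≈ℤ (+ (p ^ (n ℕ.+ s))))

  component : ∀ {n} → (Vec (Fin p) n → Vec (Fin p) n) → Vec (Fin p) n → Vec (Fin p) n → Fin p
  component F b x = dot b (F x)

  IsPlateaued : ∀ {n} → (Vec (Fin p) n → Vec (Fin p) n) → Set
  IsPlateaued {n} F = ∀ b → b ≢ zeroV → ∃ λ s → IsSPlateaued (component F b) s

{-# OPTIONS --safe #-}

-- Let q = pⁿ and let N(a, b) be the number of solutions of F(x + a) - F(x) = b.  As F is
-- (pᵗ + 1)-to-1, W_{F_b}(0) is congruent to a power of ζ modulo pᵗ + 1, hence is nonzero.
-- For plateaued F_b this forces |W_{F_b}(a)|⁴ = |W_{F_b}(0)|² |W_{F_b}(a)|² for every a, so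
-- that Σ_a |W_{F_b}(a)|⁴ = q² |W_{F_b}(0)|², which holds for b = 0 as well.  Summed over all b,
-- the left-hand side counts Σ N(a, b)² and the right-hand side the squares of the preimage sizes:
--   Σ_{a,b} N(a, b)² = q Σ_y |F⁻¹(y)|² = q (q + pᵗ (q - 1)).
-- Removing a = 0 leaves Σ_{a≠0,b} N(a, b) (N(a, b) - pᵗ) = 0.  If no N(a, b) with a ≠ 0
-- exceeds pᵗ, all terms of this sum are nonpositive and therefore vanish.
-- Traces from ℚ(ζ) to ℚ replace the cyclotomic numbers, so all sums are taken in ℤ.
module Submission where

open import Defs
open import Algebra.Bundles using (CommutativeRing)
import Algebra.Properties.AbelianGroup as AbelianGroupProperties
import Algebra.Properties.CommutativeSemigroup as CommutativeSemigroupProperties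
import Algebra.Properties.Ring as RingProperties
open import Data.Nat as ℕ using (ℕ; zero; suc; _^_; _∸_; _≤_; NonZero)
import Data.Nat.Properties as ℕ
open import Data.Nat.Coprimality using (prime⇒coprime; coprime-Bézout)
open import Data.Nat.Divisibility using (_∣_)
open import Data.Nat.DivMod using (_mod_; _%_; %-distribˡ-+; %-distribˡ-*; m<n⇒m%n≡m; n%n≡0)
open import Data.Nat.GCD using (module Bézout)
open import Data.Nat.Primality using (Prime; prime⇒nonTrivial)
open import Data.Fin as Fin using (Fin; zero; suc; toℕ)
import Data.Fin.Properties as Fin
open import Data.Integer as ℤ using (ℤ; _+_; _*_; -_; _-_; 0ℤ; 1ℤ) renaming (+_ to pos)
import Data.Integer.Properties as ℤ
open import Data.Integer.Tactic.RingSolver using (solve-∀)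
open import Data.List using (List; []; _∷_; _++_; map; concatMap; allFin; tabulate; filter; length; foldr)
open import Data.List.Membership.Propositional using (_∈_)
open import Data.List.Membership.Propositional.Properties
  using (∈-allFin; ∈-concatMap⁺; ∈-map⁺; ∈-filter⁺; ∈-filter⁻)
open import Data.List.Properties using (map-tabulate; length-tabulate; foldr-preservesᵇ; foldr-preservesᵒ)
import Data.List.Relation.Unary.All as All
import Data.List.Relation.Unary.All.Properties as All
import Data.List.Relation.Unary.Any as Any
open import Data.Product using (_×_; _,_; proj₁; proj₂; ∃)
open import Data.Sum using (_⊎_; inj₁; inj₂)
open import Data.Vec using (Vec; []; _∷_)
open import Data.Vec.Properties using (∷-injectiveˡ; ∷-injectiveʳ)
open import Function using (_∘_)
open import Function.Bundles using (_⇔_; mk⇔)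
open import Level using (0ℓ)
open import Relation.Binary.PropositionalEquality hiding (J)
open import Relation.Nullary using (Dec; yes; no; ¬_; ¬?; contradiction)
open import Relation.Unary using (Pred; Decidable)

open ≡-Reasoning

private variable
  A B : Set

-- Finite sums of integers

∑ : List A → (A → ℤ) → ℤ
∑ xs f = foldr _+_ 0ℤ (map f xs)

∑-cong : ∀ (xs : List A) {f g : A → ℤ} → (∀ x → f x ≡ g x) → ∑ xs f ≡ ∑ xs g
∑-cong []       f≡g = refl
∑-cong (x ∷ xs) f≡g = cong₂ _+_ (f≡g x) (∑-cong xs f≡g)

∑-zero : ∀ (xs : List A) → ∑ xs (λ _ → 0ℤ) ≡ 0ℤ
∑-zero []       = refl
∑-zero (x ∷ xs) = trans (ℤ.+-identityˡ _) (∑-zero xs)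

∑-+ : ∀ (xs : List A) (f g : A → ℤ) → ∑ xs (λ x → f x + g x) ≡ ∑ xs f + ∑ xs g
∑-+ []       f g = refl
∑-+ (x ∷ xs) f g = trans (cong (f x + g x +_) (∑-+ xs f g)) (rearrange (f x) (g x) _ _)
  where
  rearrange : ∀ a b c d → (a + b) + (c + d) ≡ (a + c) + (b + d)
  rearrange = solve-∀

*-∑ : ∀ c (xs : List A) (f : A → ℤ) → c * ∑ xs f ≡ ∑ xs (λ x → c * f x)
*-∑ c []       f = ℤ.*-zeroʳ c
*-∑ c (x ∷ xs) f = trans (ℤ.*-distribˡ-+ c (f x) _) (cong (c * f x +_) (*-∑ c xs f))

∑-* : ∀ (xs : List A) (f : A → ℤ) c → ∑ xs f * c ≡ ∑ xs (λ x → f x * c)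
∑-* xs f c = begin
  ∑ xs f * c             ≡⟨ ℤ.*-comm _ c ⟩
  c * ∑ xs f             ≡⟨ *-∑ c xs f ⟩
  ∑ xs (λ x → c * f x)   ≡⟨ ∑-cong xs (λ x → ℤ.*-comm c (f x)) ⟩
  ∑ xs (λ x → f x * c)   ∎

∑-const : ∀ (xs : List A) c → ∑ xs (λ _ → c) ≡ pos (length xs) * c
∑-const []       c = refl
∑-const (x ∷ xs) c = trans (cong (c +_) (∑-const xs c)) (sym (ℤ.suc-* (pos (length xs)) c))

∑-swap : ∀ (xs : List A) (ys : List B) (f : A → B → ℤ) →
  ∑ xs (λ x → ∑ ys (f x)) ≡ ∑ ys (λ y → ∑ xs (λ x → f x y))
∑-swap []       ys f = sym (∑-zero ys)
∑-swap (x ∷ xs) ys f =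
  trans (cong (∑ ys (f x) +_) (∑-swap xs ys f)) (sym (∑-+ ys (f x) _))

∑-++ : ∀ (xs ys : List A) (f : A → ℤ) → ∑ (xs ++ ys) f ≡ ∑ xs f + ∑ ys f
∑-++ []       ys f = sym (ℤ.+-identityˡ _)
∑-++ (x ∷ xs) ys f = trans (cong (f x +_) (∑-++ xs ys f)) (sym (ℤ.+-assoc (f x) _ _))

∑-map : ∀ (h : A → B) (xs : List A) (f : B → ℤ) → ∑ (map h xs) f ≡ ∑ xs (f ∘ h)
∑-map h []       f = refl
∑-map h (x ∷ xs) f = cong (f (h x) +_) (∑-map h xs f)

∑-concatMap : ∀ (h : A → List B) (xs : List A) (f : B → ℤ) →
  ∑ (concatMap h xs) f ≡ ∑ xs (λ x → ∑ (h x) f)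
∑-concatMap h []       f = refl
∑-concatMap h (x ∷ xs) f = trans (∑-++ (h x) _ f) (cong (∑ (h x) f +_) (∑-concatMap h xs f))

∑-swap-∑∑ : ∀ {C : Set} (cs : List C) (xs : List A) (ys : List B) (f : C → A → B → ℤ) →
  ∑ cs (λ c → ∑ xs (λ x → ∑ ys (f c x))) ≡ ∑ xs (λ x → ∑ ys (λ y → ∑ cs (λ c → f c x y)))
∑-swap-∑∑ cs xs ys f =
  trans (∑-swap cs xs _) (∑-cong xs (λ x → ∑-swap cs ys (λ c → f c x)))

∑-nonpos : ∀ (xs : List A) {f : A → ℤ} → (∀ x → f x ℤ.≤ 0ℤ) → ∑ xs f ℤ.≤ 0ℤ
∑-nonpos []       f≤0 = ℤ.≤-refl
∑-nonpos (x ∷ xs) f≤0 = ℤ.+-mono-≤ (f≤0 x) (∑-nonpos xs f≤0)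

-- Indicators

⟦_⟧ : {P : Set} → Dec P → ℤ
⟦ yes _ ⟧ = 1ℤ
⟦ no _ ⟧  = 0ℤ

⟦⟧-yes : {P : Set} (P? : Dec P) → P → ⟦ P? ⟧ ≡ 1ℤ
⟦⟧-yes (yes _) p = refl
⟦⟧-yes (no ¬p) p = contradiction p ¬p

⟦⟧-no : {P : Set} (P? : Dec P) → ¬ P → ⟦ P? ⟧ ≡ 0ℤ
⟦⟧-no (yes p) ¬p = contradiction p ¬p
⟦⟧-no (no _)  ¬p = refl

⟦⟧-cong : {P Q : Set} (P? : Dec P) (Q? : Dec Q) → (P → Q) → (Q → P) → ⟦ P? ⟧ ≡ ⟦ Q? ⟧
⟦⟧-cong (yes p) Q? f g = sym (⟦⟧-yes Q? (f p))
⟦⟧-cong (no ¬p) Q? f g = sym (⟦⟧-no Q? (¬p ∘ g))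

length-filter-∑ : {P : Pred A 0ℓ} (P? : Decidable P) (xs : List A) →
  pos (length (filter P? xs)) ≡ ∑ xs (λ x → ⟦ P? x ⟧)
length-filter-∑ P? []       = refl
length-filter-∑ P? (x ∷ xs) with P? x
... | yes _ = cong (λ k → 1ℤ + k) (length-filter-∑ P? xs)
... | no _  = trans (length-filter-∑ P? xs) (sym (ℤ.+-identityˡ _))

-- Sums over duplicate-free exhaustive lists

-- Says that each element occurs exactly once. Quantifying over all predicates with a single
-- solution, and not only over `_≡ v`, lets equations such as `φ y ≡ i -F k` be solved for `k`
-- directly under a sum.
Enumerates : List A → Set₁
Enumerates {A} xs = ∀ {P : Pred A 0ℓ} (P? : Decidable P) v → P v → (∀ x → P x → x ≡ v) →
  ∑ xs (λ x → ⟦ P? x ⟧) ≡ 1ℤ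

∑-none : {P : Pred A 0ℓ} (P? : Decidable P) → (∀ x → ¬ P x) →
  ∀ xs → ∑ xs (λ x → ⟦ P? x ⟧) ≡ 0ℤ
∑-none P? ¬P xs = trans (∑-cong xs (λ x → ⟦⟧-no (P? x) (¬P x))) (∑-zero xs)

module _ (xs : List A) (enum : Enumerates xs) where

  ∑-pick : {P : Pred A 0ℓ} (P? : Decidable P) (g : A → ℤ) → ∀ v → P v → (∀ x → P x → x ≡ v) →
    ∑ xs (λ x → ⟦ P? x ⟧ * g x) ≡ g v
  ∑-pick P? g v Pv P⇒≡ = begin
    ∑ xs (λ x → ⟦ P? x ⟧ * g x)   ≡⟨ ∑-cong xs (λ x → at x (P? x) (P⇒≡ x)) ⟩
    ∑ xs (λ x → ⟦ P? x ⟧ * g v)   ≡⟨ ∑-* xs _ (g v) ⟨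
    ∑ xs (λ x → ⟦ P? x ⟧) * g v   ≡⟨ cong (_* g v) (enum P? v Pv P⇒≡) ⟩
    1ℤ * g v                      ≡⟨ ℤ.*-identityˡ (g v) ⟩
    g v                           ∎
    where
    at : ∀ x {Q : Set} (Q? : Dec Q) → (Q → x ≡ v) → ⟦ Q? ⟧ * g x ≡ ⟦ Q? ⟧ * g v
    at x (yes q) eq = cong (λ y → 1ℤ * g y) (eq q)
    at x (no _)  eq = refl

  -- Exchanging the sums leaves, for each `z`, the single term at `x ≡ φ z`. This is how a sum over
  -- `zs` is regrouped by the values of `φ`.
  ∑-fibres : (_≟_ : ∀ (x y : A) → Dec (x ≡ y)) (zs : List B) (φ : B → A) (g : A → ℤ) →
    ∑ xs (λ x → ∑ zs (λ z → ⟦ φ z ≟ x ⟧) * g x) ≡ ∑ zs (λ z → g (φ z))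
  ∑-fibres _≟_ zs φ g = begin
    ∑ xs (λ x → ∑ zs (λ z → ⟦ φ z ≟ x ⟧) * g x)     ≡⟨ ∑-cong xs (λ x → ∑-* zs _ (g x)) ⟩
    ∑ xs (λ x → ∑ zs (λ z → ⟦ φ z ≟ x ⟧ * g x))     ≡⟨ ∑-swap xs zs _ ⟩
    ∑ zs (λ z → ∑ xs (λ x → ⟦ φ z ≟ x ⟧ * g x))
      ≡⟨ ∑-cong zs (λ z → ∑-pick (φ z ≟_) g (φ z) refl (λ _ → sym)) ⟩
    ∑ zs (λ z → g (φ z))                            ∎

  -- Without its term at `v` the sum is still nonpositive, so a total of zero forces `f v` to be
  -- nonnegative as well.
  vanishing : ∀ {f : A → ℤ} (_≟_ : ∀ (x y : A) → Dec (x ≡ y)) →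
    (∀ x → f x ℤ.≤ 0ℤ) → ∑ xs f ≡ 0ℤ → ∀ x → f x ≡ 0ℤ
  vanishing {f} _≟_ f≤0 ∑≡0 v = ℤ.≤-antisym (f≤0 v) 0≤fv
    where
    rest : A → ℤ
    rest x = f x - ⟦ x ≟ v ⟧ * f x
    rest≤0 : ∀ x → rest x ℤ.≤ 0ℤ
    rest≤0 x with x ≟ v
    ... | yes _ = ℤ.≤-reflexive (lem (f x))
      where
      lem : ∀ a → a - 1ℤ * a ≡ 0ℤ
      lem = solve-∀
    ... | no _  = subst (ℤ._≤ 0ℤ) (sym (lem (f x))) (f≤0 x)
      where
      lem : ∀ a → a - 0ℤ * a ≡ a
      lem = solve-∀
    ∑rest : 0ℤ ≡ ∑ xs rest + f v
    ∑rest = begin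
      0ℤ                                                ≡⟨ ∑≡0 ⟨
      ∑ xs f                                            ≡⟨ ∑-cong xs (λ x → split (f x) _) ⟩
      ∑ xs (λ x → rest x + ⟦ x ≟ v ⟧ * f x)             ≡⟨ ∑-+ xs rest _ ⟩
      ∑ xs rest + ∑ xs (λ x → ⟦ x ≟ v ⟧ * f x)
        ≡⟨ cong (∑ xs rest +_) (∑-pick (_≟ v) f v refl (λ _ eq → eq)) ⟩
      ∑ xs rest + f v                                   ∎
      where
      split : ∀ a b → a ≡ (a - b) + b
      split = solve-∀
    0≤fv : 0ℤ ℤ.≤ f v
    0≤fv = subst₂ ℤ._≤_ (sym ∑rest) (ℤ.+-identityˡ (f v))
      (ℤ.+-monoˡ-≤ (f v) (∑-nonpos xs rest≤0))

allFin-enumerates : ∀ m → Enumerates (allFin m)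
allFin-enumerates (suc m) {P} P? v Pv P⇒≡ = begin
  ⟦ P? zero ⟧ + ∑ (tabulate suc) (λ x → ⟦ P? x ⟧)
    ≡⟨ cong (λ l → ⟦ P? zero ⟧ + ∑ l (λ x → ⟦ P? x ⟧)) (map-tabulate (λ x → x) suc) ⟨
  ⟦ P? zero ⟧ + ∑ (map suc (allFin m)) (λ x → ⟦ P? x ⟧)
    ≡⟨ cong (⟦ P? zero ⟧ +_) (∑-map suc (allFin m) _) ⟩
  ⟦ P? zero ⟧ + ∑ (allFin m) (λ x → ⟦ P? (suc x) ⟧)
    ≡⟨ split v Pv P⇒≡ ⟩
  1ℤ ∎
  where
  split : ∀ v → P v → (∀ x → P x → x ≡ v) →
     ⟦ P? zero ⟧ + ∑ (allFin m) (λ x → ⟦ P? (suc x) ⟧) ≡ 1ℤ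
  split zero Pv P⇒≡ = cong₂ _+_ (⟦⟧-yes (P? zero) Pv)
    (∑-none (P? ∘ suc) (λ x Px → contradiction (P⇒≡ _ Px) λ ()) (allFin m))
  split (suc v) Pv P⇒≡ = cong₂ _+_ (⟦⟧-no (P? zero) (λ P0 → contradiction (P⇒≡ _ P0) λ ()))
    (allFin-enumerates m (P? ∘ suc) v Pv (λ x Px → Fin.suc-injective (P⇒≡ _ Px)))

module _ {p : ℕ} {{nz : NonZero p}} where

  -- Only the block of vectors with first entry `i` can contain a solution, and inside it the tails
  -- are enumerated by induction.
  allVecs-enumerates : ∀ n → Enumerates (allVecs {p} n)
  allVecs-enumerates zero P? [] Pv P⇒≡ = trans (ℤ.+-identityʳ _) (⟦⟧-yes (P? []) Pv)
  allVecs-enumerates (suc n) P? (i ∷ v) Pv P⇒≡ = begin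
    ∑ (allVecs (suc n)) (λ x → ⟦ P? x ⟧)
      ≡⟨ ∑-concatMap _ (allFin p) _ ⟩
    ∑ (allFin p) (λ j → ∑ (map (j ∷_) (allVecs n)) (λ x → ⟦ P? x ⟧))
      ≡⟨ ∑-cong (allFin p) (λ j → trans (∑-map (j ∷_) (allVecs n) _) (at j)) ⟩
    ∑ (allFin p) (λ j → ⟦ j Fin.≟ i ⟧)
      ≡⟨ allFin-enumerates p (Fin._≟ i) i refl (λ _ eq → eq) ⟩
    1ℤ ∎
    where
    at : ∀ j → ∑ (allVecs n) (λ x → ⟦ P? (j ∷ x) ⟧) ≡ ⟦ j Fin.≟ i ⟧
    at j with j Fin.≟ i
    ... | yes refl = allVecs-enumerates n (P? ∘ (i ∷_)) v Pv (λ x Px → ∷-injectiveʳ (P⇒≡ _ Px))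
    ... | no j≢i   = ∑-none (P? ∘ (j ∷_)) (λ x Px → j≢i (∷-injectiveˡ (P⇒≡ _ Px))) (allVecs n)

  -- The ring of residues

  toℕ-mod : ∀ m → toℕ (m mod p) ≡ m % p
  toℕ-mod m = Fin.toℕ-fromℕ< _

  mod-toℕ : ∀ (a : Fin p) → toℕ a mod p ≡ a
  mod-toℕ a = Fin.toℕ-injective (trans (toℕ-mod (toℕ a)) (m<n⇒m%n≡m (Fin.toℕ<n a)))

  mod-cong : ∀ {m n} → m % p ≡ n % p → m mod p ≡ n mod p
  mod-cong eq = Fin.toℕ-injective (trans (toℕ-mod _) (trans eq (sym (toℕ-mod _))))

  mod-+ : ∀ m n → (m mod p) +F (n mod p) ≡ (m ℕ.+ n) mod p
  mod-+ m n = trans (cong₂ (λ i j → (i ℕ.+ j) mod p) (toℕ-mod m) (toℕ-mod n))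
                    (mod-cong (sym (%-distribˡ-+ m n p)))

  mod-* : ∀ m n → (m mod p) *F (n mod p) ≡ (m ℕ.* n) mod p
  mod-* m n = trans (cong₂ (λ i j → (i ℕ.* j) mod p) (toℕ-mod m) (toℕ-mod n))
                    (mod-cong (sym (%-distribˡ-* m n p)))

  -- Every residue has the form `m mod p`, so a ring law for `Fin p` reduces through `mod-+` and
  -- `mod-*` to the same law in ℕ.
  residue-elim : (P : Fin p → Set) → (∀ m → P (m mod p)) → ∀ a → P a
  residue-elim P h a = subst P (mod-toℕ a) (h (toℕ a))

  p-mod-p : p mod p ≡ zeroF
  p-mod-p = mod-cong (trans (n%n≡0 p) (sym (m<n⇒m%n≡m (ℕ.>-nonZero⁻¹ p))))

  +F-comm : ∀ (a b : Fin p) → a +F b ≡ b +F a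
  +F-comm a b = cong (_mod p) (ℕ.+-comm (toℕ a) (toℕ b))

  *F-comm : ∀ (a b : Fin p) → a *F b ≡ b *F a
  *F-comm a b = cong (_mod p) (ℕ.*-comm (toℕ a) (toℕ b))

  +F-assoc : ∀ (a b c : Fin p) → (a +F b) +F c ≡ a +F (b +F c)
  +F-assoc = residue-elim _ λ k → residue-elim _ λ l → residue-elim _ λ m → begin
    ((k mod p) +F (l mod p)) +F (m mod p)   ≡⟨ cong (_+F (m mod p)) (mod-+ k l) ⟩
    ((k ℕ.+ l) mod p) +F (m mod p)          ≡⟨ mod-+ (k ℕ.+ l) m ⟩
    (k ℕ.+ l ℕ.+ m) mod p                   ≡⟨ cong (_mod p) (ℕ.+-assoc k l m) ⟩
    (k ℕ.+ (l ℕ.+ m)) mod p                 ≡⟨ mod-+ k (l ℕ.+ m) ⟨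
    (k mod p) +F ((l ℕ.+ m) mod p)          ≡⟨ cong ((k mod p) +F_) (mod-+ l m) ⟨
    (k mod p) +F ((l mod p) +F (m mod p))   ∎

  *F-assoc : ∀ (a b c : Fin p) → (a *F b) *F c ≡ a *F (b *F c)
  *F-assoc = residue-elim _ λ k → residue-elim _ λ l → residue-elim _ λ m → begin
    ((k mod p) *F (l mod p)) *F (m mod p)   ≡⟨ cong (_*F (m mod p)) (mod-* k l) ⟩
    ((k ℕ.* l) mod p) *F (m mod p)          ≡⟨ mod-* (k ℕ.* l) m ⟩
    (k ℕ.* l ℕ.* m) mod p                   ≡⟨ cong (_mod p) (ℕ.*-assoc k l m) ⟩
    (k ℕ.* (l ℕ.* m)) mod p                 ≡⟨ mod-* k (l ℕ.* m) ⟨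
    (k mod p) *F ((l ℕ.* m) mod p)          ≡⟨ cong ((k mod p) *F_) (mod-* l m) ⟨
    (k mod p) *F ((l mod p) *F (m mod p))   ∎

  *F-distribʳ-+F : ∀ (c a b : Fin p) → (a +F b) *F c ≡ (a *F c) +F (b *F c)
  *F-distribʳ-+F = residue-elim _ λ m → residue-elim _ λ k → residue-elim _ λ l → begin
    ((k mod p) +F (l mod p)) *F (m mod p)   ≡⟨ cong (_*F (m mod p)) (mod-+ k l) ⟩
    ((k ℕ.+ l) mod p) *F (m mod p)          ≡⟨ mod-* (k ℕ.+ l) m ⟩
    ((k ℕ.+ l) ℕ.* m) mod p                 ≡⟨ cong (_mod p) (ℕ.*-distribʳ-+ m k l) ⟩
    (k ℕ.* m ℕ.+ l ℕ.* m) mod p             ≡⟨ mod-+ (k ℕ.* m) (l ℕ.* m) ⟨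
    ((k ℕ.* m) mod p) +F ((l ℕ.* m) mod p)  ≡⟨ cong₂ _+F_ (mod-* k m) (mod-* l m) ⟨
    _                                       ∎

  *F-distribˡ-+F : ∀ (c a b : Fin p) → c *F (a +F b) ≡ (c *F a) +F (c *F b)
  *F-distribˡ-+F c a b = trans (*F-comm c _)
    (trans (*F-distribʳ-+F c a b) (cong₂ _+F_ (*F-comm a c) (*F-comm b c)))

  oneF : Fin p
  oneF = 1 mod p

  +F-identityˡ : ∀ (a : Fin p) → zeroF +F a ≡ a
  +F-identityˡ = residue-elim _ (mod-+ 0)

  +F-identityʳ : ∀ (a : Fin p) → a +F zeroF ≡ a
  +F-identityʳ a = trans (+F-comm a zeroF) (+F-identityˡ a)

  *F-identityˡ : ∀ (a : Fin p) → oneF *F a ≡ a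
  *F-identityˡ = residue-elim _ λ m → trans (mod-* 1 m) (cong (_mod p) (ℕ.*-identityˡ m))

  *F-identityʳ : ∀ (a : Fin p) → a *F oneF ≡ a
  *F-identityʳ a = trans (*F-comm a oneF) (*F-identityˡ a)

  +F-inverseʳ : ∀ (a : Fin p) → a +F negF a ≡ zeroF
  +F-inverseʳ a = begin
    a +F negF a                              ≡⟨ cong (_+F negF a) (mod-toℕ a) ⟨
    (toℕ a mod p) +F ((p ∸ toℕ a) mod p)     ≡⟨ mod-+ (toℕ a) (p ∸ toℕ a) ⟩
    (toℕ a ℕ.+ (p ∸ toℕ a)) mod p            ≡⟨ cong (_mod p) (ℕ.m+[n∸m]≡n (ℕ.<⇒≤ (Fin.toℕ<n a))) ⟩
    p mod p                                  ≡⟨ p-mod-p ⟩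
    zeroF                                    ∎

  +F-inverseˡ : ∀ (a : Fin p) → negF a +F a ≡ zeroF
  +F-inverseˡ a = trans (+F-comm (negF a) a) (+F-inverseʳ a)

  -- Bundled so that the general identities of abelian groups and rings apply to the operations on
  -- `Fin p`.
  residueRing : CommutativeRing 0ℓ 0ℓ
  residueRing = record
    { Carrier = Fin p ; _≈_ = _≡_ ; _+_ = _+F_ ; _*_ = _*F_ ; -_ = negF ; 0# = zeroF ; 1# = oneF
    ; isCommutativeRing = record
      { isRing = record
        { +-isAbelianGroup = record
          { isGroup = record
            { isMonoid = record
              { isSemigroup = record
                { isMagma = record { isEquivalence = isEquivalence ; ∙-cong = cong₂ _+F_ }
                ; assoc = +F-assoc }
              ; identity = +F-identityˡ , +F-identityʳ }
            ; inverse = +F-inverseˡ , +F-inverseʳ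
            ; ⁻¹-cong = cong negF }
          ; comm = +F-comm }
        ; *-cong = cong₂ _*F_
        ; *-assoc = *F-assoc
        ; *-identity = *F-identityˡ , *F-identityʳ
        ; distrib = *F-distribˡ-+F , *F-distribʳ-+F }
      ; *-comm = *F-comm } }

-- Differences, the scalar product and inverses modulo p

module _ {p : ℕ} {{nz : NonZero p}} where
  private
    module R = CommutativeRing (residueRing {p})
    module G = AbelianGroupProperties R.+-abelianGroup
    module S = CommutativeSemigroupProperties R.+-commutativeSemigroup
    module RP = RingProperties R.ring

  -F-cancel : ∀ (a : Fin p) → a -F a ≡ zeroF
  -F-cancel = +F-inverseʳ

  -F≡0⇒≡ : ∀ (a b : Fin p) → a -F b ≡ zeroF → a ≡ b
  -F≡0⇒≡ = G.x∙y⁻¹≈ε⇒x≈y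

  -F-zeroʳ : ∀ (a : Fin p) → a -F zeroF ≡ a
  -F-zeroʳ a = trans (cong (a +F_) G.ε⁻¹≈ε) (+F-identityʳ a)

  negF[a-F_] : ∀ (a b : Fin p) → negF (a -F b) ≡ b -F a
  negF[a-F_] = G.⁻¹-anti-homo‿-

  +F-F-cancel : ∀ (a b : Fin p) → (a +F b) -F a ≡ b
  +F-F-cancel = G.xyx⁻¹≈y

  -F-involutive : ∀ (a b : Fin p) → a -F (a -F b) ≡ b
  -F-involutive a b = begin
    a +F negF (a -F b)   ≡⟨ cong (a +F_) (negF[a-F_] a b) ⟩
    a +F (b -F a)        ≡⟨ +F-assoc a b (negF a) ⟨
    (a +F b) -F a        ≡⟨ +F-F-cancel a b ⟩
    b                    ∎

  +F-F-inverse : ∀ (a b : Fin p) → a +F (b -F a) ≡ b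
  +F-F-inverse a b = trans (sym (+F-assoc a b (negF a))) (+F-F-cancel a b)

  -F-interchange : ∀ (a b c d : Fin p) → (a -F b) -F (c -F d) ≡ (a -F c) -F (b -F d)
  -F-interchange a b c d = begin
    (a +F negF b) +F negF (c +F negF d)
      ≡⟨ cong ((a +F negF b) +F_) (G.⁻¹-∙-comm c (negF d)) ⟨
    (a +F negF b) +F (negF c +F negF (negF d))
      ≡⟨ S.interchange a (negF b) (negF c) (negF (negF d)) ⟩
    (a +F negF c) +F (negF b +F negF (negF d))
      ≡⟨ cong ((a +F negF c) +F_) (G.⁻¹-∙-comm b (negF d)) ⟩
    (a +F negF c) +F negF (b +F negF d) ∎

  -V-cancel : ∀ {n} (x : Vec (Fin p) n) → x -V x ≡ zeroV
  -V-cancel []      = refl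
  -V-cancel (a ∷ x) = cong₂ _∷_ (-F-cancel a) (-V-cancel x)

  -V≡0⇒≡ : ∀ {n} (x y : Vec (Fin p) n) → x -V y ≡ zeroV → x ≡ y
  -V≡0⇒≡ []      []      eq = refl
  -V≡0⇒≡ (a ∷ x) (b ∷ y) eq =
    cong₂ _∷_ (-F≡0⇒≡ a b (∷-injectiveˡ eq)) (-V≡0⇒≡ x y (∷-injectiveʳ eq))

  -V-involutive : ∀ {n} (x y : Vec (Fin p) n) → x -V (x -V y) ≡ y
  -V-involutive []      []      = refl
  -V-involutive (a ∷ x) (b ∷ y) = cong₂ _∷_ (-F-involutive a b) (-V-involutive x y)

  +V-V-cancel : ∀ {n} (x y : Vec (Fin p) n) → (x +V y) -V x ≡ y
  +V-V-cancel []      []      = refl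
  +V-V-cancel (a ∷ x) (b ∷ y) = cong₂ _∷_ (+F-F-cancel a b) (+V-V-cancel x y)

  +V-V-inverse : ∀ {n} (x y : Vec (Fin p) n) → x +V (y -V x) ≡ y
  +V-V-inverse []      []      = refl
  +V-V-inverse (a ∷ x) (b ∷ y) = cong₂ _∷_ (+F-F-inverse a b) (+V-V-inverse x y)

  +V-identityʳ : ∀ {n} (x : Vec (Fin p) n) → x +V zeroV ≡ x
  +V-identityʳ []      = refl
  +V-identityʳ (a ∷ x) = cong₂ _∷_ (+F-identityʳ a) (+V-identityʳ x)

  dot-zeroˡ : ∀ {n} (x : Vec (Fin p) n) → dot zeroV x ≡ zeroF
  dot-zeroˡ []      = refl
  dot-zeroˡ (a ∷ x) = trans (cong₂ _+F_ (R.zeroˡ a) (dot-zeroˡ x)) (+F-identityˡ zeroF)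

  dot-zeroʳ : ∀ {n} (x : Vec (Fin p) n) → dot x zeroV ≡ zeroF
  dot-zeroʳ []      = refl
  dot-zeroʳ (a ∷ x) = trans (cong₂ _+F_ (R.zeroʳ a) (dot-zeroʳ x)) (+F-identityˡ zeroF)

  dot--V : ∀ {n} (a x y : Vec (Fin p) n) → dot a (x -V y) ≡ dot a x -F dot a y
  dot--V []      []      []      = sym (-F-cancel zeroF)
  dot--V (c ∷ a) (d ∷ x) (e ∷ y) = begin
    (c *F (d -F e)) +F dot a (x -V y)
      ≡⟨ cong₂ _+F_ (RP.x[y-z]≈xy-xz c d e) (dot--V a x y) ⟩
    ((c *F d) -F (c *F e)) +F (dot a x -F dot a y)
      ≡⟨ S.interchange (c *F d) (negF (c *F e)) (dot a x) (negF (dot a y)) ⟩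
    ((c *F d) +F dot a x) +F (negF (c *F e) +F negF (dot a y))
      ≡⟨ cong (((c *F d) +F dot a x) +F_) (G.⁻¹-∙-comm (c *F e) (dot a y)) ⟩
    ((c *F d) +F dot a x) -F ((c *F e) +F dot a y) ∎

  -- A nonzero representative below the prime p is coprime to p, and the Bézout coefficient of `u`
  -- is an inverse up to sign.
  *F-inverse : Prime p → ∀ (u : Fin p) → u ≢ zeroF → ∃ λ w → u *F w ≡ oneF
  *F-inverse pr u u≢0 = go (coprime-Bézout (prime⇒coprime pr {{ℕ.≢-nonZero toℕu≢0}} (Fin.toℕ<n u)))
    where
    toℕu≢0 : toℕ u ≢ 0
    toℕu≢0 eq = u≢0 (trans (sym (mod-toℕ u)) (cong (_mod p) eq))
    p*≡0 : ∀ x → (x ℕ.* p) mod p ≡ zeroF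
    p*≡0 x = trans (sym (mod-* x p)) (trans (cong ((x mod p) *F_) p-mod-p) (R.zeroʳ (x mod p)))
    *u : ∀ y → (y ℕ.* toℕ u) mod p ≡ u *F (y mod p)
    *u y = trans (sym (mod-* y (toℕ u))) (trans (cong ((y mod p) *F_) (mod-toℕ u)) (*F-comm (y mod p) u))
    go : Bézout.Identity 1 p (toℕ u) → ∃ λ w → u *F w ≡ oneF
    -- Here 1 + y u = x p, so the inverse is -y; in the other case 1 + x p = y u, and it is y.
    go (Bézout.+- x y eq) = negF (y mod p) , (begin
      u *F negF (y mod p)     ≡⟨ RP.-‿distribʳ-* u (y mod p) ⟨
      negF (u *F (y mod p))   ≡⟨ G.inverseˡ-unique oneF (u *F (y mod p)) sum≡0 ⟨
      oneF                    ∎)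
      where
      sum≡0 : oneF +F (u *F (y mod p)) ≡ zeroF
      sum≡0 = begin
        oneF +F (u *F (y mod p))               ≡⟨ cong (oneF +F_) (*u y) ⟨
        oneF +F ((y ℕ.* toℕ u) mod p)          ≡⟨ mod-+ 1 (y ℕ.* toℕ u) ⟩
        (1 ℕ.+ y ℕ.* toℕ u) mod p              ≡⟨ cong (_mod p) eq ⟩
        (x ℕ.* p) mod p                        ≡⟨ p*≡0 x ⟩
        zeroF                                  ∎
    go (Bézout.-+ x y eq) = y mod p , (begin
      u *F (y mod p)                    ≡⟨ *u y ⟨
      (y ℕ.* toℕ u) mod p               ≡⟨ cong (_mod p) eq ⟨
      (1 ℕ.+ x ℕ.* p) mod p             ≡⟨ mod-+ 1 (x ℕ.* p) ⟨
      oneF +F ((x ℕ.* p) mod p)         ≡⟨ cong (oneF +F_) (p*≡0 x) ⟩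
      oneF +F zeroF                     ≡⟨ +F-identityʳ oneF ⟩
      oneF                              ∎)

  oneF≢zeroF : Prime p → oneF {p} ≢ zeroF
  oneF≢zeroF pr eq = contradiction 1≡0 λ ()
    where
    1<p : 1 ℕ.< p
    1<p = ℕ.nonTrivial⇒n>1 p {{prime⇒nonTrivial pr}}
    1≡0 : 1 ≡ 0
    1≡0 = begin
      1             ≡⟨ m<n⇒m%n≡m 1<p ⟨
      1 % p         ≡⟨ toℕ-mod 1 ⟨
      toℕ oneF      ≡⟨ cong toℕ eq ⟩
      toℕ zeroF     ≡⟨ toℕ-mod 0 ⟩
      0 % p         ≡⟨ m<n⇒m%n≡m (ℕ.<-trans (ℕ.s≤s ℕ.z≤n) 1<p) ⟩
      0             ∎

  -- Character sums over residues and vectors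

  -- χ k is the trace of ζ^k from ℚ(ζ) to ℚ.
  χ : Fin p → ℤ
  χ k = pos p * ⟦ k Fin.≟ zeroF ⟧ - 1ℤ

  -- The single zero of `ψ` contributes p, which cancels the p copies of -1.
  ∑-χ-bijective : ∀ (ψ : Fin p → Fin p) k₀ → ψ k₀ ≡ zeroF → (∀ k → ψ k ≡ zeroF → k ≡ k₀) →
    ∑ (allFin p) (χ ∘ ψ) ≡ 0ℤ
  ∑-χ-bijective ψ k₀ ψk₀≡0 uniq = begin
    ∑ (allFin p) (λ k → pos p * ⟦ ψ k Fin.≟ zeroF ⟧ - 1ℤ)
      ≡⟨ ∑-+ (allFin p) _ _ ⟩
    ∑ (allFin p) (λ k → pos p * ⟦ ψ k Fin.≟ zeroF ⟧) + ∑ (allFin p) (λ _ → - 1ℤ)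
      ≡⟨ cong₂ _+_ (sym (*-∑ (pos p) (allFin p) _)) (∑-const (allFin p) (- 1ℤ)) ⟩
    pos p * ∑ (allFin p) (λ k → ⟦ ψ k Fin.≟ zeroF ⟧) + pos (length (allFin p)) * - 1ℤ
      ≡⟨ cong₂ (λ s l → pos p * s + pos l * - 1ℤ)
           (allFin-enumerates p (λ k → ψ k Fin.≟ zeroF) k₀ ψk₀≡0 uniq)
           (length-tabulate {n = p} (λ x → x)) ⟩
    pos p * 1ℤ + pos p * - 1ℤ
      ≡⟨ cancel (pos p) ⟩
    0ℤ ∎
    where
    cancel : ∀ a → a * 1ℤ + a * - 1ℤ ≡ 0ℤ
    cancel = solve-∀

  -- The argument vanishes only at k = c w, where w is the inverse of `u`.
  ∑-χ-affine : Prime p → ∀ (c u : Fin p) → u ≢ zeroF →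
    ∑ (allFin p) (λ k → χ (c -F (k *F u))) ≡ 0ℤ
  ∑-χ-affine pr c u u≢0 with *F-inverse pr u u≢0
  ... | w , uw≡1 = ∑-χ-bijective _ (c *F w)
    (trans (cong (c -F_) cwu≡c) (-F-cancel c))
    (λ k eq → trans (k≡kuw k) (cong (_*F w) (sym (-F≡0⇒≡ c (k *F u) eq))))
    where
    cwu≡c : (c *F w) *F u ≡ c
    cwu≡c = trans (*F-assoc c w u) (trans (cong (c *F_) (trans (*F-comm w u) uw≡1)) (*F-identityʳ c))
    k≡kuw : ∀ k → k ≡ (k *F u) *F w
    k≡kuw k = sym (trans (*F-assoc k u w) (trans (cong (k *F_) uw≡1) (*F-identityʳ k)))

  ∣V∣ : ℕ → ℤ
  ∣V∣ n = pos (length (allVecs {p} n))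

  -- Induction on the length. If the first entry `u` is zero, the tail is nonzero and the term
  -- `i *F u` is absorbed into the constant `c`. Otherwise the sum over the first entry of `a`,
  -- taken first, already vanishes by `∑-χ-affine`.
  ∑-χ-dot-zero : Prime p → ∀ {n} (c : Fin p) (v : Vec (Fin p) n) → v ≢ zeroV →
    ∑ (allVecs n) (λ a → χ (c -F dot a v)) ≡ 0ℤ
  ∑-χ-dot-zero pr c [] v≢0 = contradiction refl v≢0
  ∑-χ-dot-zero pr {suc n} c (u ∷ v) uv≢0 = begin
    ∑ (allVecs (suc n)) (λ a → χ (c -F dot a (u ∷ v)))
      ≡⟨ ∑-concatMap _ (allFin p) _ ⟩
    ∑ (allFin p) (λ i → ∑ (map (i ∷_) (allVecs n)) (λ a → χ (c -F dot a (u ∷ v))))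
      ≡⟨ ∑-cong (allFin p) (λ i → ∑-map (i ∷_) (allVecs n) _) ⟩
    ∑ (allFin p) (λ i → ∑ (allVecs n) (λ a → χ (c -F ((i *F u) +F dot a v))))
      ≡⟨ split (u Fin.≟ zeroF) ⟩
    0ℤ ∎
    where
    -F-+F : ∀ c d e → c -F (d +F e) ≡ (c -F d) -F e
    -F-+F c d e = trans (cong (c +F_) (sym (G.⁻¹-∙-comm d e))) (sym (+F-assoc c (negF d) (negF e)))
    split : Dec (u ≡ zeroF) →
      ∑ (allFin p) (λ i → ∑ (allVecs n) (λ a → χ (c -F ((i *F u) +F dot a v)))) ≡ 0ℤ
    split (yes u≡0) = trans
      (∑-cong (allFin p) (λ i → trans
        (∑-cong (allVecs n) (λ a → cong χ (-F-+F c (i *F u) (dot a v))))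
        (∑-χ-dot-zero pr (c -F (i *F u)) v (λ v≡0 → uv≢0 (cong₂ _∷_ u≡0 v≡0)))))
      (∑-zero (allFin p))
    split (no u≢0) = trans (∑-swap (allFin p) (allVecs n) _) (trans
      (∑-cong (allVecs n) (λ a → trans
        (∑-cong (allFin p) (λ i → cong χ (trans (cong (c -F_) (+F-comm (i *F u) (dot a v)))
                                                (-F-+F c (dot a v) (i *F u)))))
        (∑-χ-affine pr (c -F dot a v) u u≢0)))
      (∑-zero (allVecs n)))

  -- Orthogonality of the characters of the vector space, multiplied by ζ^c and read through the
  -- trace.
  ∑-χ-dot : Prime p → ∀ {n} (c : Fin p) (v : Vec (Fin p) n) →
    ∑ (allVecs n) (λ a → χ (c -F dot a v)) ≡ ∣V∣ n * (⟦ v ≟V zeroV ⟧ * χ c)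
  ∑-χ-dot pr {n} c v with v ≟V zeroV
  ... | no v≢0   = trans (∑-χ-dot-zero pr c v v≢0) (zero-term (∣V∣ n) (χ c))
    where
    zero-term : ∀ a b → 0ℤ ≡ a * (0ℤ * b)
    zero-term = solve-∀
  ... | yes refl = begin
    ∑ (allVecs n) (λ a → χ (c -F dot a zeroV))
      ≡⟨ ∑-cong (allVecs n) (λ a → cong χ (trans (cong (c -F_) (dot-zeroʳ a)) (-F-zeroʳ c))) ⟩
    ∑ (allVecs n) (λ _ → χ c)
      ≡⟨ ∑-const (allVecs n) (χ c) ⟩
    ∣V∣ n * χ c
      ≡⟨ cong (∣V∣ n *_) (ℤ.*-identityˡ (χ c)) ⟨
    ∣V∣ n * (1ℤ * χ c) ∎

-- Moments of the Walsh transform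

module _ {p : ℕ} {{nz : NonZero p}} where

  -- If W is the sum of ζ^(φ x), then |W|² is the sum of ζ^(φ x - φ y) over all pairs, already in
  -- the group ring. The function `h` is extended linearly and applied to both sides.
  ∑-absSqζ : ∀ (xs : List A) (φ : A → Fin p) (c : Zζ {p}) →
    (∀ k → c k ≡ ∑ xs (λ x → ⟦ φ x Fin.≟ k ⟧)) → ∀ (h : Fin p → ℤ) →
    ∑ (allFin p) (λ k → absSqζ c k * h k) ≡ ∑ xs (λ x → ∑ xs (λ y → h (φ x -F φ y)))
  ∑-absSqζ xs φ c c≡ h = begin
    ∑ (allFin p) (λ k → ∑ (allFin p) (λ i → c i * c (negF (k -F i))) * h k)
      ≡⟨ ∑-cong (allFin p) (λ k → ∑-* (allFin p) _ (h k)) ⟩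
    ∑ (allFin p) (λ k → ∑ (allFin p) (λ i → c i * c (negF (k -F i)) * h k))
      ≡⟨ ∑-swap (allFin p) (allFin p) _ ⟩
    ∑ (allFin p) (λ i → ∑ (allFin p) (λ k → c i * c (negF (k -F i)) * h k))
      ≡⟨ ∑-cong (allFin p) (λ i → begin
           ∑ (allFin p) (λ k → c i * c (negF (k -F i)) * h k)
             ≡⟨ ∑-cong (allFin p) (λ k → ℤ.*-assoc (c i) (c (negF (k -F i))) (h k)) ⟩
           ∑ (allFin p) (λ k → c i * (c (negF (k -F i)) * h k))
             ≡⟨ *-∑ (c i) (allFin p) _ ⟨
           c i * ∑ (allFin p) (λ k → c (negF (k -F i)) * h k)
             ≡⟨ cong₂ _*_ (c≡ i) (inner i) ⟩
           ∑ xs (λ x → ⟦ φ x Fin.≟ i ⟧) * ∑ xs (λ y → h (i -F φ y)) ∎) ⟩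
    ∑ (allFin p) (λ i → ∑ xs (λ x → ⟦ φ x Fin.≟ i ⟧) * ∑ xs (λ y → h (i -F φ y)))
      ≡⟨ ∑-fibres (allFin p) (allFin-enumerates p) Fin._≟_ xs φ (λ i → ∑ xs (λ y → h (i -F φ y))) ⟩
    ∑ xs (λ x → ∑ xs (λ y → h (φ x -F φ y))) ∎
    where
    inner : ∀ i → ∑ (allFin p) (λ k → c (negF (k -F i)) * h k) ≡ ∑ xs (λ y → h (i -F φ y))
    inner i = begin
      ∑ (allFin p) (λ k → c (negF (k -F i)) * h k)
        ≡⟨ ∑-cong (allFin p) (λ k → trans
             (cong (_* h k) (trans (cong c (negF[a-F_] k i)) (c≡ (i -F k)))) (∑-* xs _ (h k))) ⟩
      ∑ (allFin p) (λ k → ∑ xs (λ y → ⟦ φ y Fin.≟ (i -F k) ⟧ * h k))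
        ≡⟨ ∑-swap (allFin p) xs _ ⟩
      ∑ xs (λ y → ∑ (allFin p) (λ k → ⟦ φ y Fin.≟ (i -F k) ⟧ * h k))
        ≡⟨ ∑-cong xs (λ y → ∑-pick (allFin p) (allFin-enumerates p) (λ k → φ y Fin.≟ (i -F k)) h (i -F φ y)
             (sym (-F-involutive i (φ y)))
             (λ k eq → trans (sym (-F-involutive i k)) (cong (i -F_) (sym eq)))) ⟩
      ∑ xs (λ y → h (i -F φ y)) ∎

  -- The linear functional with values `h` kills 1 + ζ + ... + ζ^(p-1), as these values sum to zero.
  -- It therefore depends only on the class of `c` in Z[ζ], which is the integer `N`.
  ∑-≈ℤ : ∀ {c : Zζ {p}} {N} → c ≈ℤ N → ∀ (h : Fin p → ℤ) → ∑ (allFin p) h ≡ 0ℤ →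
    ∑ (allFin p) (λ k → c k * h k) ≡ N * h zeroF
  ∑-≈ℤ {c} {N} (m , c0 , ck) h ∑h≡0 = begin
    ∑ (allFin p) (λ k → c k * h k)
      ≡⟨ ∑-cong (allFin p) (λ k → at k (k Fin.≟ zeroF)) ⟩
    ∑ (allFin p) (λ k → m * h k + ⟦ k Fin.≟ zeroF ⟧ * (N * h k))
      ≡⟨ ∑-+ (allFin p) _ _ ⟩
    ∑ (allFin p) (λ k → m * h k) + ∑ (allFin p) (λ k → ⟦ k Fin.≟ zeroF ⟧ * (N * h k))
      ≡⟨ cong₂ _+_ (sym (*-∑ m (allFin p) h))
           (∑-pick (allFin p) (allFin-enumerates p) (Fin._≟ zeroF) (λ k → N * h k) zeroF refl (λ _ eq → eq)) ⟩
    m * ∑ (allFin p) h + N * h zeroF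
      ≡⟨ cong (λ s → m * s + N * h zeroF) ∑h≡0 ⟩
    m * 0ℤ + N * h zeroF
      ≡⟨ drop m (N * h zeroF) ⟩
    N * h zeroF ∎
    where
    drop : ∀ m a → m * 0ℤ + a ≡ a
    drop = solve-∀
    at0 : ∀ m N a → (m + N) * a ≡ m * a + 1ℤ * (N * a)
    at0 = solve-∀
    at≢0 : ∀ m N a → m * a ≡ m * a + 0ℤ * (N * a)
    at≢0 = solve-∀
    at : ∀ k (d : Dec (k ≡ zeroF)) → c k * h k ≡ m * h k + ⟦ d ⟧ * (N * h k)
    at k (yes refl) = trans (cong (_* h k) c0) (at0 m N (h k))
    at k (no k≢0)   = trans (cong (_* h k) (ck k k≢0)) (at≢0 m N (h k))

  ∑-χ : ∑ (allFin p) χ ≡ 0ℤ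
  ∑-χ = ∑-χ-bijective (λ k → k) (zeroF {p}) refl (λ _ eq → eq)

  ∑-χ-reflected : ∀ (i : Fin p) → ∑ (allFin p) (λ j → χ (i -F j)) ≡ 0ℤ
  ∑-χ-reflected i = ∑-χ-bijective (i -F_) i (-F-cancel i) (λ k eq → sym (-F≡0⇒≡ i k eq))

  -- Orthogonality in the shape used for counting: the sum over `a` detects the equation `s ≡ t`.
  ∑-χ-dot-difference : Prime p → ∀ {n} (c : Fin p) (s t : Vec (Fin p) n) →
    ∑ (allVecs n) (λ a → χ (c -F (dot a s -F dot a t))) ≡ ∣V∣ n * (⟦ s ≟V t ⟧ * χ c)
  ∑-χ-dot-difference pr {n} c s t = begin
    ∑ (allVecs n) (λ a → χ (c -F (dot a s -F dot a t)))
      ≡⟨ ∑-cong (allVecs n) (λ a → cong (λ d → χ (c -F d)) (sym (dot--V a s t))) ⟩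
    ∑ (allVecs n) (λ a → χ (c -F dot a (s -V t)))
      ≡⟨ ∑-χ-dot pr c (s -V t) ⟩
    ∣V∣ n * (⟦ (s -V t) ≟V zeroV ⟧ * χ c)
      ≡⟨ cong (λ d → ∣V∣ n * (d * χ c)) (⟦⟧-cong ((s -V t) ≟V zeroV) (s ≟V t)
           (-V≡0⇒≡ s t) (λ { refl → -V-cancel s })) ⟩
    ∣V∣ n * (⟦ s ≟V t ⟧ * χ c) ∎

  module _ {n : ℕ} where

    private
      V : List (Vec (Fin p) n)
      V = allVecs n
      q : ℤ
      q = ∣V∣ {p} n

    ∑∑ : (Vec (Fin p) n → Vec (Fin p) n → ℤ) → ℤ
    ∑∑ f = ∑ V (λ x → ∑ V (f x))

    ∑∑-cong : ∀ {f g : Vec (Fin p) n → Vec (Fin p) n → ℤ} → (∀ x y → f x y ≡ g x y) → ∑∑ f ≡ ∑∑ g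
    ∑∑-cong f≡g = ∑-cong V (λ x → ∑-cong V (f≡g x))

    *-∑∑ : ∀ c (f : Vec (Fin p) n → Vec (Fin p) n → ℤ) → c * ∑∑ f ≡ ∑∑ (λ x y → c * f x y)
    *-∑∑ c f = trans (*-∑ c V _) (∑-cong V (λ x → *-∑ c V (f x)))

    ∑∑-const : ∀ c → ∑∑ (λ _ _ → c) ≡ q * (q * c)
    ∑∑-const c = trans (∑-const V (∑ V (λ _ → c))) (cong (q *_) (∑-const V c))

    module _ (f : Vec (Fin p) n → Fin p) where

      phase : Vec (Fin p) n → Vec (Fin p) n → Fin p
      phase a x = f x -F dot a x

      -- The traces of |W_f(a)|² and |W_f(a)|⁴.
      moment₂ moment₄ : Vec (Fin p) n → ℤ
      moment₂ a = ∑∑ λ x y → χ (phase a x -F phase a y)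
      moment₄ a = ∑∑ λ x y → ∑∑ λ z w → χ ((phase a x -F phase a y) -F (phase a z -F phase a w))

      ∑-absSqζ-walsh : ∀ a (h : Fin p → ℤ) →
        ∑ (allFin p) (λ k → absSqζ (walsh f a) k * h k) ≡ ∑∑ (λ x y → h (phase a x -F phase a y))
      ∑-absSqζ-walsh a = ∑-absSqζ V (phase a) (walsh f a)
        (λ k → length-filter-∑ (λ x → phase a x Fin.≟ k) V)

      moment₂-≈ℤ : ∀ a {N} → absSqζ (walsh f a) ≈ℤ N → moment₂ a ≡ N * χ zeroF
      moment₂-≈ℤ a A≈N = trans (sym (∑-absSqζ-walsh a χ)) (∑-≈ℤ A≈N χ ∑-χ)

      -- For fixed `x` and `y` the sum over `z` and `w` is the trace of ζ^i times the conjugate of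
      -- |W_f(a)|². The second factor equals the rational integer `N`, which comes out of the trace.
      moment₄-≈ℤ : ∀ a {N} → absSqζ (walsh f a) ≈ℤ N → moment₄ a ≡ N * moment₂ a
      moment₄-≈ℤ a {N} A≈N = begin
        moment₄ a
          ≡⟨ ∑∑-cong (λ x y → inner (phase a x -F phase a y)) ⟩
        ∑∑ (λ x y → N * χ (phase a x -F phase a y))
          ≡⟨ *-∑∑ N _ ⟨
        N * moment₂ a ∎
        where
        inner : ∀ i → ∑∑ (λ z w → χ (i -F (phase a z -F phase a w))) ≡ N * χ i
        inner i = begin
          ∑∑ (λ z w → χ (i -F (phase a z -F phase a w)))
            ≡⟨ ∑-absSqζ-walsh a (λ j → χ (i -F j)) ⟨
          ∑ (allFin p) (λ j → absSqζ (walsh f a) j * χ (i -F j))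
            ≡⟨ ∑-≈ℤ A≈N (λ j → χ (i -F j)) (∑-χ-reflected i) ⟩
          N * χ (i -F zeroF)
            ≡⟨ cong (λ j → N * χ j) (-F-zeroʳ i) ⟩
          N * χ i ∎

      -- Parseval's identity: summing over `a` leaves only the pairs with x = y.
      ∑-moment₂ : Prime p → ∑ V moment₂ ≡ q * (q * χ zeroF)
      ∑-moment₂ pr = begin
        ∑ V moment₂
          ≡⟨ ∑-swap-∑∑ V V V _ ⟩
        ∑∑ (λ x y → ∑ V (λ a → χ (phase a x -F phase a y)))
          ≡⟨ ∑∑-cong (λ x y → trans
               (∑-cong V (λ a → cong χ (-F-interchange (f x) (dot a x) (f y) (dot a y))))
               (∑-χ-dot-difference pr (f x -F f y) x y)) ⟩
        ∑∑ (λ x y → q * (⟦ x ≟V y ⟧ * χ (f x -F f y)))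
          ≡⟨ ∑-cong V (λ x → trans (sym (*-∑ q V _)) (cong (q *_) (trans
               (∑-pick V (allVecs-enumerates n) (x ≟V_) (λ y → χ (f x -F f y)) x refl (λ _ → sym))
               (cong χ (-F-cancel (f x)))))) ⟩
        ∑ V (λ _ → q * χ zeroF)
          ≡⟨ ∑-const V (q * χ (zeroF {p})) ⟩
        q * (q * χ zeroF) ∎

      -- All dependence on `a` can be gathered into one scalar product with (x - y) - (z - w), so
      -- orthogonality retains the quadruples for which this is zero.
      ∑-moment₄ : Prime p → ∑ V moment₄ ≡
        ∑∑ λ x y → ∑∑ λ z w → q * (⟦ (x -V y) ≟V (z -V w) ⟧ * χ ((f x -F f y) -F (f z -F f w)))
      ∑-moment₄ pr = begin
        ∑ V moment₄
          ≡⟨ ∑-swap-∑∑ V V V _ ⟩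
        ∑∑ (λ x y → ∑ V (λ a → ∑∑ λ z w → χ ((phase a x -F phase a y) -F (phase a z -F phase a w))))
          ≡⟨ ∑∑-cong (λ x y → ∑-swap-∑∑ V V V _) ⟩
        ∑∑ (λ x y → ∑∑ λ z w → ∑ V (λ a → χ ((phase a x -F phase a y) -F (phase a z -F phase a w))))
          ≡⟨ ∑∑-cong (λ x y → ∑∑-cong (λ z w → trans
               (∑-cong V (λ a → cong χ (rearrange a x y z w)))
               (∑-χ-dot-difference pr ((f x -F f y) -F (f z -F f w)) (x -V y) (z -V w)))) ⟩
        _ ∎
        where
        difference : ∀ a x y → phase a x -F phase a y ≡ (f x -F f y) -F dot a (x -V y)
        difference a x y = trans (-F-interchange (f x) (dot a x) (f y) (dot a y))
          (cong ((f x -F f y) -F_) (sym (dot--V a x y)))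
        rearrange : ∀ a x y z w → (phase a x -F phase a y) -F (phase a z -F phase a w) ≡
          ((f x -F f y) -F (f z -F f w)) -F (dot a (x -V y) -F dot a (z -V w))
        rearrange a x y z w = trans (cong₂ _-F_ (difference a x y) (difference a z w))
          (-F-interchange (f x -F f y) (dot a (x -V y)) (f z -F f w) (dot a (z -V w)))

      -- Since |W_f(a)|² is 0 or `C`, its square is always `C` times itself, and Parseval's identity
      -- evaluates the sum. As W_f(0) does not vanish, `C` can be replaced by |W_f(0)|².
      ∑-moment₄-plateaued : Prime p → ∀ {s} → IsSPlateaued f s → ¬ (absSqζ (walsh f zeroV) ≈ℤ 0ℤ) →
        ∑ V moment₄ ≡ q * (q * moment₂ zeroV)
      ∑-moment₄-plateaued pr {s} plateaued W₀≉0 = begin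
        ∑ V moment₄                    ≡⟨ ∑-cong V (λ a → amplitude a (plateaued a)) ⟩
        ∑ V (λ a → C * moment₂ a)      ≡⟨ *-∑ C V moment₂ ⟨
        C * ∑ V moment₂                ≡⟨ cong (C *_) (∑-moment₂ pr) ⟩
        C * (q * (q * χ zeroF))        ≡⟨ rearrange C q (χ zeroF) ⟩
        q * (q * (C * χ zeroF))        ≡⟨ cong (λ m → q * (q * m)) (at-zero (plateaued zeroV)) ⟨
        q * (q * moment₂ zeroV)        ∎
        where
        C : ℤ
        C = pos (p ^ (n ℕ.+ s))
        rearrange : ∀ a b c → a * (b * (b * c)) ≡ b * (b * (a * c))
        rearrange = solve-∀
        annihilate : ∀ a b c → 0ℤ * a ≡ b * (0ℤ * c)
        annihilate = solve-∀
        amplitude : ∀ a → _ → moment₄ a ≡ C * moment₂ a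
        amplitude a (inj₁ W≈0) = trans (moment₄-≈ℤ a W≈0)
          (trans (annihilate (moment₂ a) C (χ (zeroF {p}))) (cong (C *_) (sym (moment₂-≈ℤ a W≈0))))
        amplitude a (inj₂ W≈C) = moment₄-≈ℤ a W≈C
        at-zero : _ → moment₂ zeroV ≡ C * χ zeroF
        at-zero (inj₁ W≈0) = contradiction W≈0 W₀≉0
        at-zero (inj₂ W≈C) = moment₂-≈ℤ zeroV W≈C

      phase-zeroV : ∀ x → phase zeroV x ≡ f x
      phase-zeroV x = trans (cong (f x -F_) (dot-zeroˡ x)) (-F-zeroʳ (f x))

      -- This serves the component at b = 0, about which plateauedness says nothing. Every phase
      -- difference at a = 0 is zero, and both sides come to q⁴ χ(0).
      ∑-moment₄-zero : Prime p → (∀ x → f x ≡ zeroF) → ∑ V moment₄ ≡ q * (q * moment₂ zeroV)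
      ∑-moment₄-zero pr f≡0 = begin
        ∑ V moment₄
          ≡⟨ ∑-moment₄ pr ⟩
        ∑∑ (λ x y → ∑∑ λ z w → q * (⟦ (x -V y) ≟V (z -V w) ⟧ * χ ((f x -F f y) -F (f z -F f w))))
          ≡⟨ ∑∑-cong (λ x y → ∑∑-cong (λ z w → cong (λ k → q * (⟦ (x -V y) ≟V (z -V w) ⟧ * χ k))
               (trans (cong₂ _-F_ (f-f≡0 x y) (f-f≡0 z w)) (-F-cancel (zeroF {p}))))) ⟩
        ∑∑ (λ x y → ∑∑ λ z w → q * (⟦ (x -V y) ≟V (z -V w) ⟧ * χ zeroF))
          ≡⟨ ∑∑-cong (λ x y → ∑-cong V (λ z → trans (sym (*-∑ q V _)) (cong (q *_)
               -- The entries x, y and z are free and determine w = z - (x - y).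
               (∑-pick V (allVecs-enumerates n) (λ w → (x -V y) ≟V (z -V w)) (λ _ → χ zeroF)
                 (z -V (x -V y)) (sym (-V-involutive z (x -V y)))
                 (λ w eq → trans (sym (-V-involutive z w)) (cong (z -V_) (sym eq))))))) ⟩
        ∑∑ (λ x y → ∑ V (λ z → q * χ zeroF))
          ≡⟨ trans (∑∑-const (∑ V (λ _ → q * χ (zeroF {p})))) (cong (λ m → q * (q * m)) (∑-const V (q * χ zeroF))) ⟩
        q * (q * (q * (q * χ zeroF)))
          ≡⟨ cong (λ m → q * (q * m)) (∑∑-const (χ zeroF)) ⟨
        q * (q * ∑∑ (λ _ _ → χ zeroF))
          ≡⟨ cong (λ m → q * (q * m)) (∑∑-cong (λ x y → cong χ
               (trans (cong₂ _-F_ (phase-zeroV x) (phase-zeroV y)) (f-f≡0 x y)))) ⟨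
        q * (q * moment₂ zeroV) ∎
        where
        f-f≡0 : ∀ x y → f x -F f y ≡ zeroF
        f-f≡0 x y = trans (cong₂ _-F_ (f≡0 x) (f≡0 y)) (-F-cancel (zeroF {p}))

-- Counting solutions

module _ {p : ℕ} {{nz : NonZero p}} {n : ℕ} (F : Vec (Fin p) n → Vec (Fin p) n) where

  private
    V : List (Vec (Fin p) n)
    V = allVecs n
    q : ℤ
    q = ∣V∣ {p} n
    χ0 : ℤ
    χ0 = χ (zeroF {p})
    pre : Vec (Fin p) n → ℤ
    pre y = pos (preSize F y)
    sol : Vec (Fin p) n → Vec (Fin p) n → ℤ
    sol a b = pos (numSol F a b)

  ∑-preimages : ∀ (g : Vec (Fin p) n → ℤ) → ∑ V (λ y → pre y * g y) ≡ ∑ V (λ x → g (F x))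
  ∑-preimages g = trans
    (∑-cong V (λ y → cong (_* g y) (length-filter-∑ (λ x → F x ≟V y) V)))
    (∑-fibres V (allVecs-enumerates n) _≟V_ V F g)

  -- Writing the shifted argument as an independent variable x, tied to y by x - y = a, makes the
  -- count symmetric in the differences of arguments and of values.
  numSol-∑∑ : ∀ a b → sol a b ≡ ∑∑ (λ x y → ⟦ (x -V y) ≟V a ⟧ * ⟦ (F x -V F y) ≟V b ⟧)
  numSol-∑∑ a b = begin
    sol a b
      ≡⟨ length-filter-∑ (λ x → (F (x +V a) -V F x) ≟V b) V ⟩
    ∑ V (λ y → ⟦ (F (y +V a) -V F y) ≟V b ⟧)
      ≡⟨ ∑-cong V (λ y → ∑-pick V (allVecs-enumerates n) (λ x → (x -V y) ≟V a)
           (λ x → ⟦ (F x -V F y) ≟V b ⟧) (y +V a) (+V-V-cancel y a)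
           (λ x eq → trans (sym (+V-V-inverse y x)) (cong (y +V_) eq))) ⟨
    ∑ V (λ y → ∑ V (λ x → ⟦ (x -V y) ≟V a ⟧ * ⟦ (F x -V F y) ≟V b ⟧))
      ≡⟨ ∑-swap V V _ ⟩
    ∑∑ (λ x y → ⟦ (x -V y) ≟V a ⟧ * ⟦ (F x -V F y) ≟V b ⟧) ∎

  -- Each pair (x, y) is counted by exactly one N(a, b), the one with a = x - y and b = F x - F y.
  ∑-numSol-weighted : ∀ (g : Vec (Fin p) n → Vec (Fin p) n → ℤ) →
    ∑∑ (λ a b → sol a b * g a b) ≡ ∑∑ (λ x y → g (x -V y) (F x -V F y))
  ∑-numSol-weighted g = begin
    ∑∑ (λ a b → sol a b * g a b)
      ≡⟨ ∑∑-cong {n = n} expand ⟩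
    ∑∑ (λ a b → ∑∑ λ x y → ⟦ (x -V y) ≟V a ⟧ * (⟦ (F x -V F y) ≟V b ⟧ * g a b))
      ≡⟨ ∑-cong V (λ a → ∑-swap-∑∑ V V V _) ⟩
    ∑ V (λ a → ∑∑ λ x y → ∑ V (λ b → ⟦ (x -V y) ≟V a ⟧ * (⟦ (F x -V F y) ≟V b ⟧ * g a b)))
      ≡⟨ ∑-swap-∑∑ V V V _ ⟩
    ∑∑ (λ x y → ∑∑ λ a b → ⟦ (x -V y) ≟V a ⟧ * (⟦ (F x -V F y) ≟V b ⟧ * g a b))
      ≡⟨ ∑∑-cong {n = n} collapse ⟩
    ∑∑ (λ x y → g (x -V y) (F x -V F y)) ∎
    where
    expand : ∀ a b →
      sol a b * g a b ≡ ∑∑ λ x y → ⟦ (x -V y) ≟V a ⟧ * (⟦ (F x -V F y) ≟V b ⟧ * g a b)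
    expand a b = begin
      sol a b * g a b
        ≡⟨ cong (_* g a b) (numSol-∑∑ a b) ⟩
      ∑∑ (λ x y → ⟦ (x -V y) ≟V a ⟧ * ⟦ (F x -V F y) ≟V b ⟧) * g a b
        ≡⟨ trans (∑-* V _ (g a b)) (∑-cong V (λ x → ∑-* V _ (g a b))) ⟩
      ∑∑ (λ x y → ⟦ (x -V y) ≟V a ⟧ * ⟦ (F x -V F y) ≟V b ⟧ * g a b)
        ≡⟨ ∑∑-cong {n = n} (λ x y → ℤ.*-assoc ⟦ (x -V y) ≟V a ⟧ ⟦ (F x -V F y) ≟V b ⟧ (g a b)) ⟩
      ∑∑ (λ x y → ⟦ (x -V y) ≟V a ⟧ * (⟦ (F x -V F y) ≟V b ⟧ * g a b)) ∎
    collapse : ∀ x y → ∑∑ (λ a b → ⟦ (x -V y) ≟V a ⟧ * (⟦ (F x -V F y) ≟V b ⟧ * g a b))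
      ≡ g (x -V y) (F x -V F y)
    collapse x y = begin
      ∑∑ (λ a b → ⟦ (x -V y) ≟V a ⟧ * (⟦ (F x -V F y) ≟V b ⟧ * g a b))
        ≡⟨ ∑-cong V (λ a → *-∑ ⟦ (x -V y) ≟V a ⟧ V _) ⟨
      ∑ V (λ a → ⟦ (x -V y) ≟V a ⟧ * ∑ V (λ b → ⟦ (F x -V F y) ≟V b ⟧ * g a b))
        ≡⟨ ∑-pick V (allVecs-enumerates n) ((x -V y) ≟V_) _ (x -V y) refl (λ _ → sym) ⟩
      ∑ V (λ b → ⟦ (F x -V F y) ≟V b ⟧ * g (x -V y) b)
        ≡⟨ ∑-pick V (allVecs-enumerates n) ((F x -V F y) ≟V_) (g (x -V y)) (F x -V F y) refl (λ _ → sym) ⟩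
      g (x -V y) (F x -V F y) ∎

  -- Up to the factor q² χ(0), both sides count the quadruples with x - y = z - w and
  -- F x - F y = F z - F w.
  ∑-moment₄-components : Prime p →
    ∑ V (λ b → ∑ V (moment₄ (component F b))) ≡ q * (q * (χ0 * ∑∑ (λ a b → sol a b * sol a b)))
  ∑-moment₄-components pr = begin
    ∑ V (λ b → ∑ V (moment₄ (component F b)))
      ≡⟨ ∑-cong V (λ b → ∑-moment₄ (component F b) pr) ⟩
    ∑ V (λ b → ∑∑ λ x y → ∑∑ λ z w → q * (⟦ (x -V y) ≟V (z -V w) ⟧ * χ (value b x y z w)))
      ≡⟨ ∑-swap-∑∑ V V V _ ⟩
    ∑∑ (λ x y → ∑ V λ b → ∑∑ λ z w → q * (⟦ (x -V y) ≟V (z -V w) ⟧ * χ (value b x y z w)))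
      ≡⟨ ∑∑-cong {n = n} (λ x y → ∑-swap-∑∑ V V V _) ⟩
    ∑∑ (λ x y → ∑∑ λ z w → ∑ V λ b → q * (⟦ (x -V y) ≟V (z -V w) ⟧ * χ (value b x y z w)))
      ≡⟨ ∑∑-cong {n = n} (λ x y → ∑∑-cong (λ z w → over-b x y z w)) ⟩
    ∑∑ (λ x y → ∑∑ λ z w → K * (⟦ (z -V w) ≟V (x -V y) ⟧ * ⟦ (F z -V F w) ≟V (F x -V F y) ⟧))
      -- For fixed x and y, the admissible pairs (z, w) are those counted by N(x - y, F x - F y).
      ≡⟨ ∑∑-cong {n = n} (λ x y → trans (sym (*-∑∑ {n = n} K _)) (cong (K *_) (sym (numSol-∑∑ (x -V y) (F x -V F y))))) ⟩
    ∑∑ (λ x y → K * sol (x -V y) (F x -V F y))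
      ≡⟨ *-∑∑ {n = n} K _ ⟨
    K * ∑∑ (λ x y → sol (x -V y) (F x -V F y))
      ≡⟨ cong (K *_) (∑-numSol-weighted sol) ⟨
    K * ∑∑ (λ a b → sol a b * sol a b)
      ≡⟨ assoc q χ0 _ ⟩
    q * (q * (χ0 * ∑∑ (λ a b → sol a b * sol a b))) ∎
    where
    K : ℤ
    K = q * (q * χ0)
    assoc : ∀ a b c → a * (a * b) * c ≡ a * (a * (b * c))
    assoc = solve-∀
    value : ∀ b x y z w → Fin p
    value b x y z w = (component F b x -F component F b y) -F (component F b z -F component F b w)
    value≡ : ∀ b x y z w → value b x y z w ≡ zeroF -F (dot b (F z -V F w) -F dot b (F x -V F y))
    value≡ b x y z w = begin
      value b x y z w
        ≡⟨ cong₂ _-F_ (dot--V b (F x) (F y)) (dot--V b (F z) (F w)) ⟨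
      dot b (F x -V F y) -F dot b (F z -V F w)
        ≡⟨ negF[a-F_] (dot b (F z -V F w)) (dot b (F x -V F y)) ⟨
      negF (dot b (F z -V F w) -F dot b (F x -V F y))
        ≡⟨ +F-identityˡ (negF (dot b (F z -V F w) -F dot b (F x -V F y))) ⟨
      zeroF -F (dot b (F z -V F w) -F dot b (F x -V F y)) ∎
    over-b : ∀ x y z w →
      ∑ V (λ b → q * (⟦ (x -V y) ≟V (z -V w) ⟧ * χ (value b x y z w))) ≡
      K * (⟦ (z -V w) ≟V (x -V y) ⟧ * ⟦ (F z -V F w) ≟V (F x -V F y) ⟧)
    over-b x y z w = begin
      ∑ V (λ b → q * (I * χ (value b x y z w)))
        ≡⟨ *-∑ q V _ ⟨
      q * ∑ V (λ b → I * χ (value b x y z w))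
        ≡⟨ cong (q *_) (*-∑ I V _) ⟨
      q * (I * ∑ V (λ b → χ (value b x y z w)))
        ≡⟨ cong (λ s → q * (I * s)) (trans (∑-cong V (λ b → cong χ (value≡ b x y z w)))
             (∑-χ-dot-difference pr zeroF (F z -V F w) (F x -V F y))) ⟩
      q * (I * (q * (J * χ0)))
        ≡⟨ cong (λ i → q * (i * (q * (J * χ0))))
             (⟦⟧-cong ((x -V y) ≟V (z -V w)) ((z -V w) ≟V (x -V y)) sym sym) ⟩
      q * (⟦ (z -V w) ≟V (x -V y) ⟧ * (q * (J * χ0)))
        ≡⟨ rearrange q ⟦ (z -V w) ≟V (x -V y) ⟧ J χ0 ⟩
      K * (⟦ (z -V w) ≟V (x -V y) ⟧ * J) ∎
      where
      I J : ℤ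
      I = ⟦ (x -V y) ≟V (z -V w) ⟧
      J = ⟦ (F z -V F w) ≟V (F x -V F y) ⟧
      rearrange : ∀ a i j c → a * (i * (a * (j * c))) ≡ a * (a * c) * (i * j)
      rearrange = solve-∀

  -- Summing over `b` leaves the pairs with F x = F y, and counting these fibre by fibre gives the
  -- squares of the preimage sizes.
  ∑-moment₂-components : Prime p →
    ∑ V (λ b → moment₂ (component F b) zeroV) ≡ χ0 * (q * ∑ V (λ y → pre y * pre y))
  ∑-moment₂-components pr = begin
    ∑ V (λ b → moment₂ (component F b) zeroV)
      ≡⟨ ∑-swap-∑∑ V V V _ ⟩
    ∑∑ (λ x y → ∑ V (λ b → χ (phase (component F b) zeroV x -F phase (component F b) zeroV y)))
      ≡⟨ ∑∑-cong {n = n} (λ x y → trans (∑-cong V (λ b → cong χ (value≡ b x y)))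
           (∑-χ-dot-difference pr zeroF (F y) (F x))) ⟩
    ∑∑ (λ x y → q * (⟦ F y ≟V F x ⟧ * χ0))
      ≡⟨ ∑-cong V (λ x → trans (sym (*-∑ q V _)) (cong (q *_) (trans (sym (∑-* V _ χ0))
           (cong (_* χ0) (sym (length-filter-∑ (λ y → F y ≟V F x) V)))))) ⟩
    ∑ V (λ x → q * (pre (F x) * χ0))
      ≡⟨ trans (sym (*-∑ q V _)) (cong (q *_) (sym (∑-* V _ χ0))) ⟩
    q * (∑ V (λ x → pre (F x)) * χ0)
      ≡⟨ cong (λ s → q * (s * χ0)) (∑-preimages pre) ⟨
    q * (∑ V (λ y → pre y * pre y) * χ0)
      ≡⟨ rearrange q _ χ0 ⟩
    χ0 * (q * ∑ V (λ y → pre y * pre y)) ∎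
    where
    rearrange : ∀ a b c → a * (b * c) ≡ c * (a * b)
    rearrange = solve-∀
    value≡ : ∀ b x y → phase (component F b) zeroV x -F phase (component F b) zeroV y ≡
      zeroF -F (dot b (F y) -F dot b (F x))
    value≡ b x y = begin
      phase (component F b) zeroV x -F phase (component F b) zeroV y
        ≡⟨ cong₂ _-F_ (phase-zeroV (component F b) x) (phase-zeroV (component F b) y) ⟩
      dot b (F x) -F dot b (F y)
        ≡⟨ negF[a-F_] (dot b (F y)) (dot b (F x)) ⟨
      negF (dot b (F y) -F dot b (F x))
        ≡⟨ +F-identityˡ (negF (dot b (F y) -F dot b (F x))) ⟨
      zeroF -F (dot b (F y) -F dot b (F x)) ∎

  -- The trace of 1 is p - 1, which is nonzero because p exceeds 1.
  χ0≢0 : Prime p → χ0 ≢ 0ℤ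
  χ0≢0 pr eq = ℕ.<⇒≢ (ℕ.nonTrivial⇒n>1 p {{prime⇒nonTrivial pr}}) (sym (ℤ.+-injective (begin
    pos p                      ≡⟨ split (pos p) ⟩
    (pos p * 1ℤ - 1ℤ) + 1ℤ     ≡⟨ cong (λ i → (pos p * i - 1ℤ) + 1ℤ) (⟦⟧-yes (zeroF {p} Fin.≟ zeroF) refl) ⟨
    χ0 + 1ℤ         ≡⟨ cong (_+ 1ℤ) eq ⟩
    1ℤ                         ∎)))
    where
    split : ∀ a → a ≡ (a * 1ℤ - 1ℤ) + 1ℤ
    split = solve-∀

  -- An empty list could not count the zero vector once.
  q≢0 : q ≢ 0ℤ
  q≢0 eq = contradiction 1≡0 λ ()
    where
    empty : ∀ (xs : List (Vec (Fin p) n)) f → pos (length xs) ≡ 0ℤ → ∑ xs f ≡ 0ℤ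
    empty [] f _ = refl
    1≡0 : 1ℤ ≡ 0ℤ
    1≡0 = trans (sym (allVecs-enumerates n (_≟V zeroV) zeroV refl (λ _ e → e))) (empty V _ eq)

  *-cancelˡ : ∀ c {a b : ℤ} → c ≢ 0ℤ → c * a ≡ c * b → a ≡ b
  *-cancelˡ c c≢0 = ℤ.*-cancelˡ-≡ c _ _ {{ℤ.≢-nonZero c≢0}}

  -- Both evaluations of the fourth moments, summed over all components, carry the nonzero factor q²
  -- χ(0), which is cancelled.
  ∑-numSol² : Prime p → (∀ b → ∑ V (moment₄ (component F b)) ≡ q * (q * moment₂ (component F b) zeroV)) →
    ∑∑ (λ a b → sol a b * sol a b) ≡ q * ∑ V (λ y → pre y * pre y)
  ∑-numSol² pr moments = *-cancelˡ χ0 (χ0≢0 pr) (*-cancelˡ q q≢0 (*-cancelˡ q q≢0 (begin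
    q * (q * (χ0 * ∑∑ (λ a b → sol a b * sol a b)))
      ≡⟨ ∑-moment₄-components pr ⟨
    ∑ V (λ b → ∑ V (moment₄ (component F b)))
      ≡⟨ ∑-cong V moments ⟩
    ∑ V (λ b → q * (q * moment₂ (component F b) zeroV))
      ≡⟨ trans (sym (*-∑ q V _)) (cong (q *_) (sym (*-∑ q V _))) ⟩
    q * (q * ∑ V (λ b → moment₂ (component F b) zeroV))
      ≡⟨ cong (λ s → q * (q * s)) (∑-moment₂-components pr) ⟩
    q * (q * (χ0 * (q * ∑ V (λ y → pre y * pre y)))) ∎)))

-- Consequences of the d-to-1 property

module _ {p : ℕ} {{nz : NonZero p}} {n : ℕ} (F : Vec (Fin p) n → Vec (Fin p) n) where

  private
    V : List (Vec (Fin p) n)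
    V = allVecs n
    q : ℤ
    q = ∣V∣ {p} n
    pre : Vec (Fin p) n → ℤ
    pre y = pos (preSize F y)
    sol : Vec (Fin p) n → Vec (Fin p) n → ℤ
    sol a b = pos (numSol F a b)

  module _ {d : ℕ} (y₀ : Vec (Fin p) n) (pre-y₀ : preSize F y₀ ≡ 1)
    (pre-y : ∀ y → y ≢ y₀ → (preSize F y ≡ 0) ⊎ (preSize F y ≡ d)) where

    private
      D : ℤ
      D = pos d
      ∣W∣² : Vec (Fin p) n → Zζ {p}
      ∣W∣² b = absSqζ (walsh (component F b) zeroV)

    preSize-mod-d : ∀ y → ∃ λ e → pre y ≡ D * e + ⟦ y ≟V y₀ ⟧
    preSize-mod-d y with y ≟V y₀
    ... | yes refl = 0ℤ , trans (cong pos pre-y₀) (at D)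
      where
      at : ∀ a → 1ℤ ≡ a * 0ℤ + 1ℤ
      at = solve-∀
    ... | no y≢y₀ with pre-y y y≢y₀
    ...   | inj₁ eq = 0ℤ , trans (cong pos eq) (at D)
      where
      at : ∀ a → 0ℤ ≡ a * 0ℤ + 0ℤ
      at = solve-∀
    ...   | inj₂ eq = 1ℤ , trans (cong pos eq) (at D)
      where
      at : ∀ a → a ≡ a * 1ℤ + 0ℤ
      at = solve-∀

    -- Grouped by values of F, the transform at 0 is the sum of |F⁻¹(y)| ζ^(b·y). Modulo `d` only y₀
    -- survives, so it is congruent to ζ^(b·y₀) coefficient by coefficient.
    walsh-mod-d : ∀ b k → ∃ λ e → walsh (component F b) zeroV k ≡ D * e + ⟦ dot b y₀ Fin.≟ k ⟧
    walsh-mod-d b k = ∑ V (λ y → e y * I y) , (begin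
      walsh (component F b) zeroV k
        ≡⟨ length-filter-∑ (λ x → phase (component F b) zeroV x Fin.≟ k) V ⟩
      ∑ V (λ x → ⟦ phase (component F b) zeroV x Fin.≟ k ⟧)
        ≡⟨ ∑-cong V (λ x → cong (λ j → ⟦ j Fin.≟ k ⟧) (phase-zeroV (component F b) x)) ⟩
      ∑ V (λ x → I (F x))
        ≡⟨ ∑-preimages F I ⟨
      ∑ V (λ y → pre y * I y)
        ≡⟨ ∑-cong V (λ y → trans (cong (_* I y) (proj₂ (preSize-mod-d y)))
             (expand D (e y) ⟦ y ≟V y₀ ⟧ (I y))) ⟩
      ∑ V (λ y → D * (e y * I y) + ⟦ y ≟V y₀ ⟧ * I y)
        ≡⟨ ∑-+ V _ _ ⟩
      ∑ V (λ y → D * (e y * I y)) + ∑ V (λ y → ⟦ y ≟V y₀ ⟧ * I y)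
        ≡⟨ cong₂ _+_ (sym (*-∑ D V _))
             (∑-pick V (allVecs-enumerates n) (_≟V y₀) I y₀ refl (λ _ eq → eq)) ⟩
      D * ∑ V (λ y → e y * I y) + I y₀ ∎)
      where
      e I : Vec (Fin p) n → ℤ
      e y = proj₁ (preSize-mod-d y)
      I y = ⟦ dot b y Fin.≟ k ⟧
      expand : ∀ D e i j → (D * e + i) * j ≡ D * (e * j) + i * j
      expand = solve-∀

    -- A power of ζ times its conjugate is 1, so |W|² is congruent to 1 modulo `d`. The indicator,
    -- in the shape left by the convolution, is that of k = 0.
    absSqζ-walsh-mod-d : ∀ b k → ∃ λ e →
      ∣W∣² b k ≡ D * e + ⟦ dot b y₀ Fin.≟ negF (k -F dot b y₀) ⟧
    absSqζ-walsh-mod-d b k = ∑ (allFin p) X , (begin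
      ∑ (allFin p) (λ i → W i * W (negF (k -F i)))
        ≡⟨ ∑-cong (allFin p) (λ i → trans
             (cong₂ _*_ (proj₂ (walsh-mod-d b i)) (proj₂ (walsh-mod-d b (negF (k -F i)))))
             (expand D (E i) (I i) (E (negF (k -F i))) (I (negF (k -F i))))) ⟩
      ∑ (allFin p) (λ i → D * X i + I i * I (negF (k -F i)))
        ≡⟨ ∑-+ (allFin p) _ _ ⟩
      ∑ (allFin p) (λ i → D * X i) + ∑ (allFin p) (λ i → I i * I (negF (k -F i)))
        ≡⟨ cong₂ _+_ (sym (*-∑ D (allFin p) X))
             (∑-pick (allFin p) (allFin-enumerates p) (dot b y₀ Fin.≟_) (λ i → I (negF (k -F i)))
               (dot b y₀) refl (λ _ → sym)) ⟩
      D * ∑ (allFin p) X + I (negF (k -F dot b y₀)) ∎)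
      where
      W E I X : Fin p → ℤ
      W = walsh (component F b) zeroV
      E i = proj₁ (walsh-mod-d b i)
      I i = ⟦ dot b y₀ Fin.≟ i ⟧
      X i = D * (E i * E (negF (k -F i))) + (E i * I (negF (k -F i)) + I i * E (negF (k -F i)))
      expand : ∀ D e i f j →
        (D * e + i) * (D * f + j) ≡ D * (D * (e * f) + (e * j + i * f)) + i * j
      expand = solve-∀

    -- Were |W|² zero in Z[ζ], all its group ring coefficients would agree. Those at 0 and 1 are
    -- congruent to 1 and 0 modulo `d`, so `d` would divide 1.
    walsh-zeroV≉0 : Prime p → 2 ≤ d → ∀ b → ¬ (∣W∣² b ≈ℤ 0ℤ)
    walsh-zeroV≉0 pr 2≤d b (m , A0 , Ak) = ℕ.<⇒≢ 2≤d (sym d≡1)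
      where
      k₀ : Fin p
      k₀ = dot b y₀
      e₀ e₁ : ℤ
      e₀ = proj₁ (absSqζ-walsh-mod-d b zeroF)
      e₁ = proj₁ (absSqζ-walsh-mod-d b oneF)
      I₀ : ⟦ k₀ Fin.≟ negF (zeroF -F k₀) ⟧ ≡ 1ℤ
      I₀ = ⟦⟧-yes (k₀ Fin.≟ negF (zeroF -F k₀))
        (sym (trans (negF[a-F_] zeroF k₀) (-F-zeroʳ k₀)))
      I₁ : ⟦ k₀ Fin.≟ negF (oneF -F k₀) ⟧ ≡ 0ℤ
      I₁ = ⟦⟧-no (k₀ Fin.≟ negF (oneF -F k₀)) λ eq → oneF≢zeroF pr (begin
        oneF                  ≡⟨ -F-involutive k₀ oneF ⟨
        k₀ -F (k₀ -F oneF)    ≡⟨ cong (k₀ -F_) (trans eq (negF[a-F_] oneF k₀)) ⟨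
        k₀ -F k₀              ≡⟨ -F-cancel k₀ ⟩
        zeroF                 ∎)
      D∣1 : D * (e₁ - e₀) ≡ 1ℤ
      D∣1 = begin
        D * (e₁ - e₀)                            ≡⟨ expand D e₁ e₀ ⟩
        (D * e₁ + 0ℤ) - (D * e₀ + 1ℤ) + 1ℤ
          ≡⟨ cong₂ (λ i j → (D * e₁ + i) - (D * e₀ + j) + 1ℤ) I₁ I₀ ⟨
        (D * e₁ + ⟦ k₀ Fin.≟ negF (oneF -F k₀) ⟧) - (D * e₀ + ⟦ k₀ Fin.≟ negF (zeroF -F k₀) ⟧) + 1ℤ
          ≡⟨ cong₂ (λ i j → i - j + 1ℤ) (proj₂ (absSqζ-walsh-mod-d b oneF))
                                        (proj₂ (absSqζ-walsh-mod-d b zeroF)) ⟨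
        ∣W∣² b oneF - ∣W∣² b zeroF + 1ℤ                ≡⟨ cong₂ (λ i j → i - j + 1ℤ) (Ak oneF (oneF≢zeroF pr)) A0 ⟩
        m - (m + 0ℤ) + 1ℤ                        ≡⟨ cancel m ⟩
        1ℤ                                       ∎
        where
        expand : ∀ D a b → D * (a - b) ≡ (D * a + 0ℤ) - (D * b + 1ℤ) + 1ℤ
        expand = solve-∀
        cancel : ∀ m → m - (m + 0ℤ) + 1ℤ ≡ 1ℤ
        cancel = solve-∀
      d≡1 : d ≡ 1
      d≡1 = ℕ.m*n≡1⇒m≡1 d ℤ.∣ e₁ - e₀ ∣ (trans (sym (ℤ.abs-* D (e₁ - e₀))) (cong ℤ.∣_∣ D∣1))

    -- A size s in {0, d} satisfies s² = d s, and the exceptional size 1 satisfies 1 = d + (1 - d).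
    -- The sizes themselves add up to q.
    ∑-preSize² : ∑ V (λ y → pre y * pre y) ≡ D * q + (1ℤ - D)
    ∑-preSize² = begin
      ∑ V (λ y → pre y * pre y)
        ≡⟨ ∑-cong V square ⟩
      ∑ V (λ y → D * (pre y * 1ℤ) + ⟦ y ≟V y₀ ⟧ * (1ℤ - D))
        ≡⟨ ∑-+ V _ _ ⟩
      ∑ V (λ y → D * (pre y * 1ℤ)) + ∑ V (λ y → ⟦ y ≟V y₀ ⟧ * (1ℤ - D))
        ≡⟨ cong₂ _+_ (trans (sym (*-∑ D V _)) (cong (D *_) (∑-preimages F (λ _ → 1ℤ))))
             (∑-pick V (allVecs-enumerates n) (_≟V y₀) (λ _ → 1ℤ - D) y₀ refl (λ _ eq → eq)) ⟩
      D * ∑ V (λ _ → 1ℤ) + (1ℤ - D)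
        ≡⟨ cong (λ s → D * s + (1ℤ - D)) (trans (∑-const V 1ℤ) (ℤ.*-identityʳ q)) ⟩
      D * q + (1ℤ - D) ∎
      where
      square : ∀ y → pre y * pre y ≡ D * (pre y * 1ℤ) + ⟦ y ≟V y₀ ⟧ * (1ℤ - D)
      square y with y ≟V y₀
      ... | yes refl = trans (cong (λ m → pos m * pos m) pre-y₀)
        (trans (at D) (cong (λ m → D * (pos m * 1ℤ) + 1ℤ * (1ℤ - D)) (sym pre-y₀)))
        where
        at : ∀ D → 1ℤ ≡ D * 1ℤ + 1ℤ * (1ℤ - D)
        at = solve-∀
      ... | no y≢y₀ with pre-y y y≢y₀
      ...   | inj₁ eq = trans (cong (λ m → pos m * pos m) eq)
        (trans (at D) (cong (λ m → D * (pos m * 1ℤ) + 0ℤ * (1ℤ - D)) (sym eq)))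
        where
        at : ∀ D → 0ℤ ≡ D * 0ℤ + 0ℤ * (1ℤ - D)
        at = solve-∀
      ...   | inj₂ eq = trans (cong (λ m → pos m * pos m) eq)
        (trans (at D) (cong (λ m → D * (pos m * 1ℤ) + 0ℤ * (1ℤ - D)) (sym eq)))
        where
        at : ∀ D → D * D ≡ D * (D * 1ℤ) + 0ℤ * (1ℤ - D)
        at = solve-∀

  ∑-numSol : ∑∑ sol ≡ q * (q * 1ℤ)
  ∑-numSol = begin
    ∑∑ sol                     ≡⟨ ∑∑-cong {n = n} (λ a b → sym (ℤ.*-identityʳ (sol a b))) ⟩
    ∑∑ (λ a b → sol a b * 1ℤ)  ≡⟨ ∑-numSol-weighted F (λ _ _ → 1ℤ) ⟩
    ∑∑ {n = n} (λ _ _ → 1ℤ)    ≡⟨ ∑∑-const {n = n} 1ℤ ⟩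
    q * (q * 1ℤ)               ∎

  numSol-zeroV : ∀ b → sol zeroV b ≡ ⟦ zeroV ≟V b ⟧ * q
  numSol-zeroV b = begin
    sol zeroV b
      ≡⟨ length-filter-∑ (λ x → (F (x +V zeroV) -V F x) ≟V b) V ⟩
    ∑ V (λ x → ⟦ (F (x +V zeroV) -V F x) ≟V b ⟧)
      ≡⟨ ∑-cong V (λ x → cong (λ v → ⟦ v ≟V b ⟧)
           (trans (cong (λ y → F y -V F x) (+V-identityʳ x)) (-V-cancel (F x)))) ⟩
    ∑ V (λ _ → ⟦ zeroV ≟V b ⟧)
      ≡⟨ ∑-const V _ ⟩
    q * ⟦ zeroV ≟V b ⟧
      ≡⟨ ℤ.*-comm q ⟦ zeroV ≟V b ⟧ ⟩
    ⟦ zeroV ≟V b ⟧ * q ∎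

  -- The excess of the solution counts over pᵗ

  module _ (t : ℕ) (pr : Prime p) (plateaued : IsPlateaued F) (dto1 : IsDTo1 F (suc (p ^ t))) where

    private
      P D : ℤ
      P = pos (p ^ t)
      D = pos (suc (p ^ t))
      y₀ : Vec (Fin p) n
      y₀ = proj₁ (proj₂ dto1)
      pre-y₀ : preSize F y₀ ≡ 1
      pre-y₀ = proj₁ (proj₂ (proj₂ dto1))
      pre-y : ∀ y → y ≢ y₀ → (preSize F y ≡ 0) ⊎ (preSize F y ≡ suc (p ^ t))
      pre-y = proj₂ (proj₂ (proj₂ dto1))
      excess : Vec (Fin p) n → ℤ
      excess a = ∑ V (λ b → sol a b * (sol a b - P))

    moments : ∀ b → ∑ V (moment₄ (component F b)) ≡ q * (q * moment₂ (component F b) zeroV)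
    moments b with b ≟V zeroV
    ... | yes refl = ∑-moment₄-zero (component F zeroV) pr (λ x → dot-zeroˡ (F x))
    ... | no b≢0   = ∑-moment₄-plateaued (component F b) pr (proj₂ (plateaued b b≢0))
      -- Here d = pᵗ + 1 is at least 2 because pᵗ is positive.
      (walsh-zeroV≉0 y₀ pre-y₀ pre-y pr (ℕ.s≤s (ℕ.m^n>0 p t)) b)

    ∑-excess : ∑ V excess ≡ q * (q - P)
    ∑-excess = begin
      ∑∑ (λ a b → sol a b * (sol a b - P))
        ≡⟨ ∑∑-cong {n = n} (λ a b → expand (sol a b) P) ⟩
      ∑∑ (λ a b → sol a b * sol a b + - P * sol a b)
        ≡⟨ trans (∑-cong V (λ a → ∑-+ V _ _)) (∑-+ V _ _) ⟩
      ∑∑ (λ a b → sol a b * sol a b) + ∑∑ (λ a b → - P * sol a b)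
        ≡⟨ cong₂ _+_ (trans (∑-numSol² F pr moments) (cong (q *_) (∑-preSize² y₀ pre-y₀ pre-y)))
             (trans (sym (*-∑∑ {n = n} (- P) sol)) (cong (- P *_) ∑-numSol)) ⟩
      q * (D * q + (1ℤ - D)) + - P * (q * (q * 1ℤ))
        ≡⟨ simplify q P ⟩
      q * (q - P) ∎
      where
      expand : ∀ s P → s * (s - P) ≡ s * s + - P * s
      expand = solve-∀
      simplify : ∀ q P → q * ((1ℤ + P) * q + (1ℤ - (1ℤ + P))) + - P * (q * (q * 1ℤ)) ≡ q * (q - P)
      simplify = solve-∀

    -- For a = 0 the difference is identically zero, so the only nonzero count is N(0, 0) = q.
    excess-zeroV : excess zeroV ≡ q * (q - P)
    excess-zeroV = trans (∑-cong V at) (∑-pick V (allVecs-enumerates n) (zeroV ≟V_)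
      (λ _ → q * (q - P)) zeroV refl (λ _ → sym))
      where
      at : ∀ b → sol zeroV b * (sol zeroV b - P) ≡ ⟦ zeroV ≟V b ⟧ * (q * (q - P))
      at b = trans (cong (λ s → s * (s - P)) (numSol-zeroV b)) (split (zeroV ≟V b))
        where
        one : ∀ q P → 1ℤ * q * (1ℤ * q - P) ≡ 1ℤ * (q * (q - P))
        one = solve-∀
        none : ∀ q P → 0ℤ * q * (0ℤ * q - P) ≡ 0ℤ * (q * (q - P))
        none = solve-∀
        split : {Q : Set} (d : Dec Q) → ⟦ d ⟧ * q * (⟦ d ⟧ * q - P) ≡ ⟦ d ⟧ * (q * (q - P))
        split (yes _) = one q P
        split (no _)  = none q P

    -- The total excess is already attained at a = 0. An indicator excludes that term, so that the
    -- sum still runs over all of `V` and `vanishing` applies to it.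
    ∑-excess-nonzero : ∑ V (λ a → ⟦ ¬? (a ≟V zeroV) ⟧ * excess a) ≡ 0ℤ
    ∑-excess-nonzero = begin
      ∑ V (λ a → ⟦ ¬? (a ≟V zeroV) ⟧ * excess a)
        ≡⟨ ∑-cong V (λ a → complement (a ≟V zeroV) (excess a)) ⟩
      ∑ V (λ a → excess a + - 1ℤ * (⟦ a ≟V zeroV ⟧ * excess a))
        ≡⟨ ∑-+ V _ _ ⟩
      ∑ V excess + ∑ V (λ a → - 1ℤ * (⟦ a ≟V zeroV ⟧ * excess a))
        ≡⟨ cong₂ _+_ ∑-excess (trans (sym (*-∑ (- 1ℤ) V _)) (cong (- 1ℤ *_) (trans
             (∑-pick V (allVecs-enumerates n) (_≟V zeroV) excess zeroV refl (λ _ eq → eq))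
             excess-zeroV))) ⟩
      q * (q - P) + - 1ℤ * (q * (q - P))
        ≡⟨ cancel (q * (q - P)) ⟩
      0ℤ ∎
      where
      cancel : ∀ a → a + - 1ℤ * a ≡ 0ℤ
      cancel = solve-∀
      one : ∀ a → 0ℤ * a ≡ a + - 1ℤ * (1ℤ * a)
      one = solve-∀
      none : ∀ a → 1ℤ * a ≡ a + - 1ℤ * (0ℤ * a)
      none = solve-∀
      complement : {Q : Set} (d : Dec Q) → ∀ a → ⟦ ¬? d ⟧ * a ≡ a + - 1ℤ * (⟦ d ⟧ * a)
      complement (yes _) = one
      complement (no _)  = none

    -- Under the bound every N (N - pᵗ) with a ≠ 0 is nonpositive. `vanishing` is applied first to
    -- the sum over `a` and then to the sum over `b`, and a vanishing product leaves the two values.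
    numSol-two-valued : (∀ a → a ≢ zeroV → ∀ b → numSol F a b ≤ p ^ t) →
      ∀ a → a ≢ zeroV → ∀ b → (numSol F a b ≡ 0) ⊎ (numSol F a b ≡ p ^ t)
    numSol-two-valued bound a a≢0 b = split (ℤ.i*j≡0⇒i≡0∨j≡0 (sol a b) term≡0)
      where
      term≤0 : ∀ a → a ≢ zeroV → ∀ b → sol a b * (sol a b - P) ℤ.≤ 0ℤ
      term≤0 a a≢0 b = subst (sol a b * (sol a b - P) ℤ.≤_) (ℤ.*-zeroʳ (sol a b))
        (ℤ.*-monoˡ-≤-nonNeg (sol a b) (ℤ.i≤j⇒i-j≤0 (ℤ.+≤+ (bound a a≢0 b))))
      restricted≤0 : ∀ a → ⟦ ¬? (a ≟V zeroV) ⟧ * excess a ℤ.≤ 0ℤ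
      restricted≤0 a with a ≟V zeroV
      ... | yes _  = ℤ.≤-refl
      ... | no a≢0 = subst (ℤ._≤ 0ℤ) (sym (ℤ.*-identityˡ (excess a))) (∑-nonpos V (term≤0 a a≢0))
      excess≡0 : excess a ≡ 0ℤ
      excess≡0 = begin
        excess a                               ≡⟨ ℤ.*-identityˡ (excess a) ⟨
        1ℤ * excess a                          ≡⟨ cong (_* excess a) (⟦⟧-yes (¬? (a ≟V zeroV)) a≢0) ⟨
        ⟦ ¬? (a ≟V zeroV) ⟧ * excess a
          ≡⟨ vanishing V (allVecs-enumerates n) _≟V_ restricted≤0 ∑-excess-nonzero a ⟩
        0ℤ                                     ∎
      term≡0 : sol a b * (sol a b - P) ≡ 0ℤ
      term≡0 = vanishing V (allVecs-enumerates n) _≟V_ (term≤0 a a≢0) excess≡0 b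
      split : sol a b ≡ 0ℤ ⊎ sol a b - P ≡ 0ℤ → _
      split (inj₁ eq) = inj₁ (ℤ.+-injective eq)
      split (inj₂ eq) = inj₂ (ℤ.+-injective (ℤ.i-j≡0⇒i≡j (sol a b) P eq))

  -- The differential uniformity as a maximum

  diffUnif≤ : ∀ {m} → (∀ a → a ≢ zeroV → ∀ b → numSol F a b ≤ m) → diffUnif F ≤ m
  diffUnif≤ {m} bound = foldr-preservesᵇ {P = _≤ m} ℕ.⊔-lub ℕ.z≤n
    (All.concat⁺ {xss = map (λ a → map (numSol F a) V) (nonzeroVecs n)}
      (All.map⁺ (All.tabulate λ {a} a∈ → All.map⁺ (All.tabulate λ {b} _ →
        bound a (proj₂ (∈-filter⁻ (λ a → ¬? (a ≟V zeroV)) {xs = V} a∈)) b))))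

module _ {p : ℕ} {{nz : NonZero p}} where

  ∈-allVecs : ∀ {n} (v : Vec (Fin p) n) → v ∈ allVecs n
  ∈-allVecs []      = Any.here refl
  ∈-allVecs (i ∷ v) = ∈-concatMap⁺ _ (Any.map (λ { refl → ∈-map⁺ (i ∷_) (∈-allVecs v) }) (∈-allFin i))

  module _ {n : ℕ} (F : Vec (Fin p) n → Vec (Fin p) n) where

    numSol≤diffUnif : ∀ {a} → a ≢ zeroV → ∀ b → numSol F a b ≤ diffUnif F
    numSol≤diffUnif {a} a≢0 b = foldr-preservesᵒ {P = numSol F a b ≤_}
      (λ { x y (inj₁ s≤x) → ℕ.≤-trans s≤x (ℕ.m≤m⊔n x y)
         ; x y (inj₂ s≤y) → ℕ.≤-trans s≤y (ℕ.m≤n⊔m x y) }) 0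
      (concatMap (λ a → map (numSol F a) (allVecs n)) (nonzeroVecs n))
      (inj₂ (Any.map ℕ.≤-reflexive (∈-concatMap⁺ (λ a → map (numSol F a) (allVecs n)) {xs = nonzeroVecs n}
        (Any.map (λ { refl → ∈-map⁺ (numSol F a) (∈-allVecs b) })
          (∈-filter⁺ (λ a → ¬? (a ≟V zeroV)) (∈-allVecs a) a≢0)))))

    numSol-attained : ∀ a x → numSol F a (F (x +V a) -V F x) ≢ 0
    numSol-attained a x eq = nonempty (∈-filter⁺ (λ y → (F (y +V a) -V F y) ≟V (F (x +V a) -V F x))
      (∈-allVecs x) refl) eq
      where
      nonempty : ∀ {ys} → x ∈ ys → length ys ≢ 0
      nonempty (Any.here _)  ()
      nonempty (Any.there _) ()

    module _ (t : ℕ) (pr : Prime p) (plateaued : IsPlateaued F) (dto1 : IsDTo1 F (suc (p ^ t))) where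

      two-valued : diffUnif F ≤ p ^ t →
        ∀ a → a ≢ zeroV → ∀ b → (numSol F a b ≡ 0) ⊎ (numSol F a b ≡ p ^ t)
      two-valued U≤pᵗ = numSol-two-valued F t pr plateaued dto1
        (λ a a≢0 b → ℕ.≤-trans (numSol≤diffUnif a≢0 b) U≤pᵗ)

      -- A smaller maximum would still make the counts two-valued; a nonzero count would then equal
      -- pᵗ and exceed that maximum.
      pᵗ≤diffUnif : ∀ a → a ≢ zeroV → p ^ t ≤ diffUnif F
      pᵗ≤diffUnif a a≢0 = ℕ.≮⇒≥ λ U<pᵗ → absurd U<pᵗ (two-valued (ℕ.<⇒≤ U<pᵗ) a a≢0 b)
        where
        b : Vec (Fin p) n
        -- The difference attained at x = 0, which makes the count for this `b` nonzero.
        b = F (zeroV +V a) -V F zeroV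
        absurd : diffUnif F ℕ.< p ^ t → ¬ (numSol F a b ≡ 0 ⊎ numSol F a b ≡ p ^ t)
        absurd _    (inj₁ s≡0)  = numSol-attained a zeroV s≡0
        absurd U<pᵗ (inj₂ s≡pᵗ) = ℕ.<⇒≱ U<pᵗ (subst (_≤ diffUnif F) s≡pᵗ (numSol≤diffUnif a≢0 b))

theorem5p5 : (p n t : ℕ) {{nz : NonZero p}} → Prime p → 1 ≤ n →
    suc (p ^ t) ∣ (p ^ n ∸ 1) →
    (F : Vec (Fin p) n → Vec (Fin p) n) → IsPlateaued F → IsDTo1 F (suc (p ^ t)) →
    (p ^ t ≤ diffUnif F) ×
    ((diffUnif F ≡ p ^ t) ⇔
    (∀ (a : Vec (Fin p) n) → a ≢ zeroV → ∀ b → (numSol F a b ≡ 0) ⊎ (numSol F a b ≡ p ^ t)))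
theorem5p5 p (suc n) t pr _ _ F plateaued dto1 = lower-bound , mk⇔
    (λ U≡pᵗ → two-valued F t pr plateaued dto1 (ℕ.≤-reflexive U≡pᵗ))
    (λ values → ℕ.≤-antisym (diffUnif≤ F λ a a≢0 b → bounded (values a a≢0 b)) lower-bound)
  where
  lower-bound : p ^ t ≤ diffUnif F
  -- A nonzero direction exists because the dimension is at least 1.
  lower-bound = pᵗ≤diffUnif F t pr plateaued dto1 (oneF ∷ zeroV) (λ eq → oneF≢zeroF pr (∷-injectiveˡ eq))
  bounded : ∀ {m} → m ≡ 0 ⊎ m ≡ p ^ t → m ≤ p ^ t
  bounded (inj₁ refl) = ℕ.z≤n
  bounded (inj₂ refl) = ℕ.≤-refl
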